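{- For all positive integers $d$ and $p$, (i) $\displaystyle \left|B(d,p)\cap\mathbb{P}^d_\circ\right|=\frac{1}{2}\sum_{j=1}^{d}2^j\binom{d}{j}\sum_{i=j}^{p}c_\psi(i,j)$, and (ii) $\displaystyle \kappa\!\left(B(d,p)\cap\mathbb{P}^d_\circ\right)=\frac{1}{2d}\sum_{j=1}^{d}2^j\binom{d}{j}\sum_{i=j}^{p}i\,c_\psi(i,j)$, where for positive integers $p,d$, $$c_\psi(p,d)=\frac{1}{(d-1)!}\sum_{i=1}^{d}s(d,i)\,J_{i-1}(p).$$
   Context: A point of $\mathbb{Z}^d$ is primitive if its coordinates are relatively prime; $\mathbb{P}^d$ is the set of primitive points of $\mathbb{Z}^d$, and $\mathbb{P}^d_\circ$ is the set of points of $\mathbb{P}^d$ whose first non-zero coordinate is positive. $B(d,p)=\{x\in\mathbb{R}^d:\|x\|_1\le p\}$. For a finite set $\mathcal{X}\subset\mathbb{R}^d$, $\kappa(\mathcal{X})=\max_{1\le i\le d}\sum_{x\in\mathcal{X}}|x_i|$. $J_q$ is Jordan's totient function: $J_q(p)=p^q\prod_{n}(1-n^{ -q})$, the product over the primes $n$ dividing $p$ (so $J_0(1)=1$ and $J_0(p)=0$ for $p>1$). $s(d,i)$ are the (signed) Stirling numbers of the first kind, given by $s(d+1,i)=-d\,s(d,i)+s(d,i-1)$, $s(i,i)=1$, and $s(d,0)=0$ for $d>0$. -}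

module Defs where

open import Data.Integer.Base as ℤ using (ℤ; +_; -_; 0ℤ)
import Data.Integer.Properties as ℤₚ
open import Data.Fin.Base as Fin using (Fin)
import Data.Fin.Properties as Finₚ
open import Data.List.Base as List
  using (List; []; _∷_; length; map; filter; foldr; upTo; allFin; deduplicate; cartesianProductWith; _++_)
open import Data.List.Extrema.Nat using (max)
open import Data.List.Membership.Propositional using (_∈_)
open import Data.List.Membership.Propositional.Properties
  using (∈-map⁺; ∈-++⁺ˡ; ∈-++⁺ʳ; ∈-upTo⁺; ∈-filter⁺; ∈-filter⁻; ∈-deduplicate⁻; ∈-deduplicate⁺; ∈-cartesianProductWith⁺)
open import Data.List.Relation.Unary.Any using (here)
open import Data.List.Relation.Unary.Unique.Propositional using (Unique)
import Data.List.Relation.Unary.Unique.DecPropositional.Properties as DecUnique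
open import Data.Nat.Base as ℕ using (ℕ; zero; suc; _∸_; _≤_; _^_; _!; NonZero)
open import Data.Nat.ListAction using (sum)
open import Data.Nat.Divisibility using (_∣_; _∣?_)
open import Data.Nat.GCD using (gcd)
open import Data.Nat.Primality using (Prime; prime?)
import Data.Nat.Properties as ℕₚ
open import Data.Product.Base using (∃; _×_; _,_; proj₁; proj₂)
open import Data.Rational.Base as ℚ using (ℚ; 0ℚ; 1ℚ; _/_)
open import Data.Vec.Base as Vec using (Vec; []; _∷_; lookup)
import Data.Vec.Properties as Vecₚ
open import Function.Base using (_∘_)
open import Function.Bundles using (_⇔_; mk⇔; Equivalence)
open import Level using (Level)
open import Relation.Binary.Definitions using (DecidableEquality)
open import Relation.Binary.PropositionalEquality using (_≡_; refl; subst; sym)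
open import Relation.Nullary.Decidable using (_×-dec_; _→-dec_)
open import Relation.Unary using (Pred; Decidable; _∩_)

-- The finiteness of P: a list of its elements, without
-- repetition.
record Enumeration {a ℓ : Level} {A : Set a} (P : Pred A ℓ) : Set (a Level.⊔ ℓ) where
  field
    elements : List A
    unique   : Unique elements
    ∈⇔       : ∀ {x} → x ∈ elements ⇔ P x

  card : ℕ
  card = length elements

open Enumeration public using (card)

ℤ^ : ℕ → Set
ℤ^ d = Vec ℤ d

‖_‖₁ : ∀ {d} → ℤ^ d → ℕ
‖ x ‖₁ = Vec.sum (Vec.map ℤ.∣_∣ x)

-- The integer points of the ℓ₁-ball of radius p.
B : (d p : ℕ) → Pred (ℤ^ d) _
B d p x = ‖ x ‖₁ ≤ p

ℙ : (d : ℕ) → Pred (ℤ^ d) _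
ℙ d x = Vec.foldr′ gcd 0 (Vec.map ℤ.∣_∣ x) ≡ 1

FirstNonzeroPositive : ∀ {d} → Pred (ℤ^ d) _
FirstNonzeroPositive x =
  ∃ λ i → (∀ j → j Fin.< i → lookup x j ≡ 0ℤ) × 0ℤ ℤ.< lookup x i

ℙ∘ : (d : ℕ) → Pred (ℤ^ d) _
ℙ∘ d = ℙ d ∩ FirstNonzeroPositive

-- All the sums are natural numbers, so for d > 0 the base value 0 does not
-- affect the maximum.
κ : ∀ {d ℓ} {P : Pred (ℤ^ d) ℓ} → Enumeration P → ℕ
κ {d} X = max 0 (map (λ i → sum (map (λ x → ℤ.∣ lookup x i ∣) elements)) (allFin d))
  where open Enumeration X

fromℤ : ℤ → ℚ
fromℤ z = z / 1

fromℕ : ℕ → ℚ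
fromℕ n = fromℤ (+ n)

-- Sum of f a, …, f b; it is empty if b < a.
∑ : (a b : ℕ) → (ℕ → ℚ) → ℚ
∑ a b f = foldr ℚ._+_ 0ℚ (map (λ k → f (a ℕ.+ k)) (upTo (suc b ∸ a)))

syntax ∑ a b (λ i → e) = ∑[ i from a to b ] e

∏ : List ℚ → ℚ
∏ = foldr ℚ._*_ 1ℚ

-- Jordan's totient J_q(p), for p > 0.  A prime n is represented by its
-- predecessor k, so that n = suc k is visibly non-zero; as n divides p,
-- k ranges over 0, …, p - 1.
J : (q p : ℕ) → ℚ
J q p = fromℕ (p ^ q) ℚ.* ∏ (map eulerFactor predPrimeDivisors)
  where
  predPrimeDivisors : List ℕ
  predPrimeDivisors = filter (λ k → prime? (suc k) ×-dec (suc k ∣? p)) (upTo p)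

  eulerFactor : ℕ → ℚ
  eulerFactor k = 1ℚ ℚ.- (+ 1 / (suc k ^ q)) {{ℕₚ.m^n≢0 (suc k) q}}

-- Signed Stirling numbers of the first kind.  Using s(0,i) = 0 for i > 0,
-- the condition s(i,i) = 1 for i > 0 follows from the recurrence (s-diagonal).
s : ℕ → ℕ → ℤ
s zero    zero    = + 1
s zero    (suc i) = 0ℤ
s (suc d) zero    = 0ℤ
s (suc d) (suc i) = (- (+ d)) ℤ.* s d (suc i) ℤ.+ s d i

-- Used only for p, d > 0, where ∸ is ordinary subtraction.
cψ : (p d : ℕ) → ℚ
cψ p d = (+ 1 / ((d ∸ 1) !)) {{ℕₚ._!≢0 (d ∸ 1)}} ℚ.*
         ∑[ i from 1 to d ] (fromℤ (s d i) ℚ.* J (i ∸ 1) p)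

s-above : ∀ {d i} → d ℕ.< i → s d i ≡ 0ℤ
s-above {zero}  {suc i} _ = refl
s-above {suc d} {suc i} (ℕ.s≤s d<i)
  rewrite s-above {d} {suc i} (ℕₚ.m<n⇒m<1+n d<i) | s-above d<i
        | ℤₚ.*-zeroʳ (- (+ d)) = refl

s-diagonal : ∀ i → s i i ≡ + 1
s-diagonal zero = refl
s-diagonal (suc i)
  rewrite s-above (ℕₚ.n<1+n i) | s-diagonal i | ℤₚ.*-zeroʳ (- (+ i)) = refl

private
  interval : ℕ → List ℤ
  interval p = map +_ (upTo (suc p)) ++ map (-_ ∘ +_) (upTo (suc p))

  ∈-interval : ∀ {p} z → ℤ.∣ z ∣ ≤ p → z ∈ interval p
  ∈-interval (+ n) n≤p = ∈-++⁺ˡ (∈-map⁺ +_ (∈-upTo⁺ (ℕ.s≤s n≤p)))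
  ∈-interval {p} ℤ.-[1+ n ] n<p =
    ∈-++⁺ʳ (map +_ (upTo (suc p))) (∈-map⁺ (-_ ∘ +_) (∈-upTo⁺ (ℕ.s≤s n<p)))

  box : (d p : ℕ) → List (ℤ^ d)
  box zero    p = [] ∷ []
  box (suc d) p = cartesianProductWith _∷_ (interval p) (box d p)

  ∈-box : ∀ {d p} {x : ℤ^ d} → B d p x → x ∈ box d p
  ∈-box {x = []}    _     = here refl
  ∈-box {x = z ∷ x} ‖x‖≤p = ∈-cartesianProductWith⁺ _∷_
    (∈-interval z (ℕₚ.≤-trans (ℕₚ.m≤m+n ℤ.∣ z ∣ ‖ x ‖₁) ‖x‖≤p))
    (∈-box {x = x} (ℕₚ.≤-trans (ℕₚ.m≤n+m ‖ x ‖₁ ℤ.∣ z ∣) ‖x‖≤p))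

  B∩ℙ∘? : ∀ d p → Decidable (B d p ∩ ℙ∘ d)
  B∩ℙ∘? d p x = (‖ x ‖₁ ℕₚ.≤? p) ×-dec (_ ℕₚ.≟ 1) ×-dec
    Finₚ.any? λ i →
      Finₚ.all? (λ j → (j Finₚ.<? i) →-dec (lookup x j ℤₚ.≟ 0ℤ)) ×-dec (0ℤ ℤₚ.<? lookup x i)

  _≟_ : ∀ {d} → DecidableEquality (ℤ^ d)
  _≟_ = Vecₚ.≡-dec ℤₚ._≟_

B∩ℙ∘-finite : ∀ d p → Enumeration (B d p ∩ ℙ∘ d)
B∩ℙ∘-finite d p = record
  { elements = deduplicate _≟_ points
  ; unique   = DecUnique.deduplicate-! _≟_ points
  ; ∈⇔       = mk⇔
      (λ x∈ → proj₂ (∈-filter⁻ (B∩ℙ∘? d p) {xs = box d p} (∈-deduplicate⁻ _≟_ points x∈)))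
      (λ px → ∈-deduplicate⁺ _≟_ (∈-filter⁺ (B∩ℙ∘? d p) (∈-box (proj₁ px)) px))
  }
  where
  points : List (ℤ^ d)
  points = filter (B∩ℙ∘? d p) (box d p)

{-# OPTIONS --safe #-}
module Submission where

-- If p is a prime dividing n, the points of norm n with all coordinates
-- divisible by p are the multiples by p of the points of norm n / p.  So
-- removing one prime after another turns any count that is a combination of
-- the powers n ^ q, for n > 0, into the same combination of
-- n ^ q ∏ (1 − p ^ −q) = J_q(n): there is no need for Möbius inversion.  The
-- number of all points of norm n is the sum over j of 2 ^ j (d C j) times the
-- number of compositions of n into j parts, which the Stirling numbers expand
-- in powers of n.  Finally x ↦ − x pairs the points of ℙ∘ with the other
-- primitive points, and the primitive points of the ball are invariant under
-- permutation of the coordinates, so that all the sums in κ are equal.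

open import Defs
open import Data.Empty using (⊥)
open import Data.Fin.Base using (Fin; zero; suc)
open import Data.Integer.Base as ℤ using (ℤ; +_; +0; +[1+_]; -[1+_]; 0ℤ; ∣_∣; +<+) renaming (-_ to neg)
import Data.Integer.Properties as ℤₚ
open import Data.List.Base using (List; []; _∷_; _++_; length; filter; foldr; map; upTo; applyUpTo; allFin)
open import Data.List.Extrema.Nat using (max≤v⁺; v≤max⁺)
open import Data.List.Membership.Propositional using (_∈_)
open import Data.List.Membership.Propositional.Properties
  using (∈-map⁺; ∈-map⁻; ∈-++⁺ˡ; ∈-++⁺ʳ; ∈-++⁻; ∈-filter⁺; ∈-filter⁻; ∈-upTo⁺)
open import Data.List.Membership.Propositional.Properties.WithK using (unique∧set⇒bag)
import Data.List.Properties as Listₚ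
open import Data.List.Relation.Binary.BagAndSetEquality using (∼bag⇒↭)
open import Data.List.Relation.Binary.Permutation.Propositional using (_↭_)
import Data.List.Relation.Binary.Permutation.Propositional.Properties as ↭ₚ
open import Data.List.Relation.Unary.All as All using (All; []; _∷_)
import Data.List.Relation.Unary.All.Properties as Allₚ
open import Data.List.Relation.Unary.AllPairs using ([]; _∷_)
open import Data.List.Relation.Unary.Any using (here)
open import Data.List.Relation.Unary.Unique.Propositional using (Unique)
import Data.List.Relation.Unary.Unique.Propositional.Properties as Uniqueₚ
open import Data.Nat.Base as ℕ using (ℕ; zero; suc; NonZero; _^_; _∸_; _!; _≤_; _<_; z≤n; s≤s) renaming (_*_ to _*ℕ_)
open import Data.Nat.Combinatorics using (_C_; nCk+nC[k+1]≡[n+1]C[k+1]; k>n⇒nCk≡0)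
open import Data.Nat.Divisibility
  using (_∣_; _∣?_; divides; ∣-refl; ∣-trans; ∣1⇒≡1; ∣⇒≤; m∣m*n; ∣n⇒∣m*n; ∣m∣n⇒∣m+n; 0∣⇒≡0)
open import Data.Nat.GCD using (gcd; gcd[m,n]∣m; gcd[m,n]∣n; gcd-identityˡ; gcd-comm; gcd-assoc; c*gcd[m,n]≡gcd[cm,cn])
open import Data.Nat.ListAction using (sum; product)
open import Data.Nat.ListAction.Properties using (sum-↭; sum-++)
open import Data.Nat.Primality using (Prime; prime?; euclidsLemma; prime⇒irreducible; ¬prime[1])
open import Data.Nat.Primality.Factorisation using (factorise)
open import Data.Nat.Properties as ℕₚ using (m*n≢0)
open import Data.Nat.Solver using () renaming (module +-*-Solver to ℕ-Solver)
open import Data.Product.Base using (∃; _×_; _,_; proj₁; proj₂)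
open import Data.Rational.Base using (ℚ; 0ℚ; 1ℚ; ½; _/_; _+_; _*_; _-_; -_; toℚᵘ)
open import Data.Rational.Properties as ℚₚ using (toℚᵘ-injective; toℚᵘ-fromℚᵘ; toℚᵘ-homo-+; toℚᵘ-homo-*)
open import Data.Rational.Solver using () renaming (module +-*-Solver to ℚ-Solver)
open import Data.Rational.Unnormalised.Base as ℚᵘ using (mkℚᵘ; *≡*)
import Data.Rational.Unnormalised.Properties as ℚᵘₚ
open import Data.Sum.Base using (_⊎_; inj₁; inj₂; [_,_]′)
open import Data.Vec.Base as Vec using (Vec; []; _∷_; _[_]≔_; lookup; head)
import Data.Vec.Properties as Vecₚ
open import Function.Base using (_∘_; id)
open import Function.Bundles using (mk⇔; Equivalence)
open import Level using (Level)
open import Relation.Binary.PropositionalEquality hiding (J)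
open import Relation.Nullary.Decidable using (yes; no; ¬?; _×-dec_)
open import Relation.Nullary.Negation using (¬_; contradiction)
open import Relation.Unary using (Pred; Decidable; _∩_)

-- The embedding of the integers in the rationals.

fromℤ-homo-+ : ∀ a b → fromℤ (a ℤ.+ b) ≡ fromℤ a + fromℤ b
fromℤ-homo-+ a b = toℚᵘ-injective (begin
  toℚᵘ (fromℤ (a ℤ.+ b))               ≈⟨ toℚᵘ-fromℚᵘ (mkℚᵘ (a ℤ.+ b) 0) ⟩
  mkℚᵘ (a ℤ.+ b) 0                     ≈⟨ *≡* (cong (ℤ._* + 1) (sym (cong₂ ℤ._+_ (ℤₚ.*-identityʳ a) (ℤₚ.*-identityʳ b)))) ⟩
  mkℚᵘ a 0 ℚᵘ.+ mkℚᵘ b 0               ≈⟨ ℚᵘₚ.+-cong (toℚᵘ-fromℚᵘ (mkℚᵘ a 0)) (toℚᵘ-fromℚᵘ (mkℚᵘ b 0)) ⟨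
  toℚᵘ (fromℤ a) ℚᵘ.+ toℚᵘ (fromℤ b)   ≈⟨ toℚᵘ-homo-+ (fromℤ a) (fromℤ b) ⟨
  toℚᵘ (fromℤ a + fromℤ b)             ∎)
  where open ℚᵘₚ.≃-Reasoning

fromℤ-homo-* : ∀ a b → fromℤ (a ℤ.* b) ≡ fromℤ a * fromℤ b
fromℤ-homo-* a b = toℚᵘ-injective (begin
  toℚᵘ (fromℤ (a ℤ.* b))               ≈⟨ toℚᵘ-fromℚᵘ (mkℚᵘ (a ℤ.* b) 0) ⟩
  mkℚᵘ a 0 ℚᵘ.* mkℚᵘ b 0               ≈⟨ ℚᵘₚ.*-cong (toℚᵘ-fromℚᵘ (mkℚᵘ a 0)) (toℚᵘ-fromℚᵘ (mkℚᵘ b 0)) ⟨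
  toℚᵘ (fromℤ a) ℚᵘ.* toℚᵘ (fromℤ b)   ≈⟨ toℚᵘ-homo-* (fromℤ a) (fromℤ b) ⟨
  toℚᵘ (fromℤ a * fromℤ b)             ∎)
  where open ℚᵘₚ.≃-Reasoning

fromℤ-homo-neg : ∀ a → fromℤ (ℤ.- a) ≡ - fromℤ a
fromℤ-homo-neg a = begin
  fromℤ (ℤ.- a)               ≡⟨ cong fromℤ (ℤₚ.-1*i≡-i a) ⟨
  fromℤ (ℤ.-1ℤ ℤ.* a)         ≡⟨ fromℤ-homo-* ℤ.-1ℤ a ⟩
  - 1ℚ * fromℤ a              ≡⟨ ℚₚ.neg-distribˡ-* 1ℚ (fromℤ a) ⟨
  - (1ℚ * fromℤ a)            ≡⟨ cong -_ (ℚₚ.*-identityˡ (fromℤ a)) ⟩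
  - fromℤ a                   ∎
  where open ≡-Reasoning

fromℕ-homo-+ : ∀ m n → fromℕ (m ℕ.+ n) ≡ fromℕ m + fromℕ n
fromℕ-homo-+ m n = fromℤ-homo-+ (+ m) (+ n)

fromℕ-homo-* : ∀ m n → fromℕ (m *ℕ n) ≡ fromℕ m * fromℕ n
fromℕ-homo-* m n = trans (cong fromℤ (ℤₚ.pos-* m n)) (fromℤ-homo-* (+ m) (+ n))

1/n*n≡1 : ∀ n .{{_ : NonZero n}} → + 1 / n * fromℕ n ≡ 1ℚ
1/n*n≡1 (suc n) = toℚᵘ-injective (begin
  toℚᵘ (+ 1 / suc n * fromℕ (suc n))              ≈⟨ toℚᵘ-homo-* (+ 1 / suc n) (fromℕ (suc n)) ⟩
  toℚᵘ (+ 1 / suc n) ℚᵘ.* toℚᵘ (fromℕ (suc n))    ≈⟨ ℚᵘₚ.*-cong (toℚᵘ-fromℚᵘ (mkℚᵘ (+ 1) n)) (toℚᵘ-fromℚᵘ (mkℚᵘ (+ suc n) 0)) ⟩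
  mkℚᵘ (+ 1) n ℚᵘ.* mkℚᵘ (+ suc n) 0              ≈⟨ *≡* (trans (ℤₚ.*-identityʳ _) (cong (ℤ._*_ (+ 1)) (sym (ℤₚ.*-identityʳ (+ suc n))))) ⟩
  toℚᵘ 1ℚ                                         ∎)
  where open ℚᵘₚ.≃-Reasoning

-- Finite sums of rationals.

Σ< : ℕ → (ℕ → ℚ) → ℚ
Σ< n f = foldr _+_ 0ℚ (applyUpTo f n)

∑≡Σ< : ∀ a b f → ∑ a b f ≡ Σ< (suc b ∸ a) (λ k → f (a ℕ.+ k))
∑≡Σ< a b f = cong (foldr _+_ 0ℚ) (Listₚ.map-upTo (λ k → f (a ℕ.+ k)) (suc b ∸ a))

Σ<-cong : ∀ n {f g : ℕ → ℚ} → (∀ k → k < n → f k ≡ g k) → Σ< n f ≡ Σ< n g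
Σ<-cong zero    f≗g = refl
Σ<-cong (suc n) f≗g = cong₂ _+_ (f≗g 0 ℕ.z<s) (Σ<-cong n (λ k k<n → f≗g (suc k) (s≤s k<n)))

Σ<-+ : ∀ n f g → Σ< n (λ k → f k + g k) ≡ Σ< n f + Σ< n g
Σ<-+ zero    f g = refl
Σ<-+ (suc n) f g rewrite Σ<-+ n (f ∘ suc) (g ∘ suc) =
  solve 4 (λ a b c d → (a :+ b) :+ (c :+ d) := (a :+ c) :+ (b :+ d)) refl
    (f 0) (g 0) (Σ< n (f ∘ suc)) (Σ< n (g ∘ suc))
  where open ℚ-Solver

*-Σ< : ∀ c n f → c * Σ< n f ≡ Σ< n (λ k → c * f k)
*-Σ< c zero    f = ℚₚ.*-zeroʳ c
*-Σ< c (suc n) f = trans (ℚₚ.*-distribˡ-+ c (f 0) _) (cong (_+_ (c * f 0)) (*-Σ< c n (f ∘ suc)))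

Σ<-zero : ∀ n → Σ< n (λ _ → 0ℚ) ≡ 0ℚ
Σ<-zero zero    = refl
Σ<-zero (suc n) = trans (ℚₚ.+-identityˡ _) (Σ<-zero n)

Σ<-swap : ∀ m n (f : ℕ → ℕ → ℚ) → Σ< m (λ i → Σ< n (f i)) ≡ Σ< n (λ j → Σ< m (λ i → f i j))
Σ<-swap zero    n f = sym (Σ<-zero n)
Σ<-swap (suc m) n f = trans (cong (_+_ (Σ< n (f 0))) (Σ<-swap m n (f ∘ suc)))
                            (sym (Σ<-+ n (f 0) (λ j → Σ< m (λ i → f (suc i) j))))

Σ<-last : ∀ n f → Σ< (suc n) f ≡ Σ< n f + f n
Σ<-last zero    f = ℚₚ.+-comm (f 0) 0ℚ
Σ<-last (suc n) f = trans (cong (_+_ (f 0)) (Σ<-last n (f ∘ suc))) (sym (ℚₚ.+-assoc (f 0) (Σ< n (f ∘ suc)) (f (suc n))))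

-- Lets an inner sum that starts at `j` run over all positive `i ≤ p`, so that the order of
-- summation can be exchanged. If `n < a`, truncated subtraction leaves an empty sum on the left,
-- and the hypothesis kills every term on the right.
Σ<-drop : ∀ a n f → (∀ k → k < a → k < n → f k ≡ 0ℚ) → Σ< (n ∸ a) (λ k → f (a ℕ.+ k)) ≡ Σ< n f
Σ<-drop zero    n       f f≡0 = refl
Σ<-drop (suc a) zero    f f≡0 = refl
Σ<-drop (suc a) (suc n) f f≡0 = begin
  Σ< (n ∸ a) (λ k → f (suc a ℕ.+ k))  ≡⟨ Σ<-drop a n (f ∘ suc) (λ k k<a k<n → f≡0 (suc k) (s≤s k<a) (s≤s k<n)) ⟩
  Σ< n (f ∘ suc)                      ≡⟨ ℚₚ.+-identityˡ (Σ< n (f ∘ suc)) ⟨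
  0ℚ + Σ< n (f ∘ suc)                 ≡⟨ cong (_+ Σ< n (f ∘ suc)) (f≡0 0 ℕ.z<s ℕ.z<s) ⟨
  Σ< (suc n) f                        ∎
  where open ≡-Reasoning

-- Linear functionals and sieving by primes.

-- The arguments are functions of an exponent `q`, typically `q ↦ n ^ q`. Removing a prime only
-- subtracts, so preserving differences is all that is asked; `ext` takes the place of function
-- extensionality.
record Linear (φ : (ℕ → ℚ) → ℚ) : Set where
  field
    ext    : ∀ {f g} → f ≗ g → φ f ≡ φ g
    homo-- : ∀ f g → φ (λ q → f q - g q) ≡ φ f - φ g

open Linear

linear-at : ∀ i → Linear (λ f → f i)
linear-at i = record { ext = λ f≗g → f≗g i ; homo-- = λ f g → refl }

linear-* : ∀ c {φ} → Linear φ → Linear (λ f → c * φ f)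
linear-* c {φ} L = record
  { ext    = λ f≗g → cong (c *_) (ext L f≗g)
  ; homo-- = λ f g → trans (cong (c *_) (homo-- L f g))
      (solve 3 (λ c a b → c :* (a :- b) := c :* a :- c :* b) refl c (φ f) (φ g))
  }
  where open ℚ-Solver

linear-+ : ∀ {φ ψ} → Linear φ → Linear ψ → Linear (λ f → φ f + ψ f)
linear-+ {φ} {ψ} L M = record
  { ext    = λ f≗g → cong₂ _+_ (ext L f≗g) (ext M f≗g)
  ; homo-- = λ f g → trans (cong₂ _+_ (homo-- L f g) (homo-- M f g))
      (solve 4 (λ a b c d → (a :- b) :+ (c :- d) := (a :+ c) :- (b :+ d)) refl
        (φ f) (φ g) (ψ f) (ψ g))
  }
  where open ℚ-Solver

linear-∑ : ∀ a b {φ : ℕ → (ℕ → ℚ) → ℚ} → (∀ i → Linear (φ i)) → Linear (λ f → ∑[ i from a to b ] φ i f)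
linear-∑ a b {φ} L = go (upTo (suc b ∸ a))
  where
  go : ∀ ks → Linear (λ f → foldr _+_ 0ℚ (map (λ k → φ (a ℕ.+ k) f) ks))
  go []       = record { ext = λ _ → refl ; homo-- = λ _ _ → refl }
  go (k ∷ ks) = linear-+ (L (a ℕ.+ k)) (go ks)

^-distribʳ-* : ∀ m n q → (m *ℕ n) ^ q ≡ m ^ q *ℕ n ^ q
^-distribʳ-* m n zero    = refl
^-distribʳ-* m n (suc q) rewrite ^-distribʳ-* m n q =
  solve 4 (λ m n x y → m :* n :* (x :* y) := m :* x :* (n :* y)) refl m n (m ^ q) (n ^ q)
  where open ℕ-Solver

-- As in J, a prime is represented by its predecessor.
eulerProduct : ℕ → List ℕ → ℚ
eulerProduct q ks = ∏ (map (λ k → 1ℚ - (+ 1 / (suc k ^ q)) {{ℕₚ.m^n≢0 (suc k) q}}) ks)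

-- With `P = suc k ^ q`, the new factor `1 − 1/P` turns `P * m ^ q` into `P * m ^ q − m ^ q`. This
-- is the recursion that a count satisfies when one more prime is sieved out.
power-eulerProduct : ∀ k m q ks →
  fromℕ ((suc k *ℕ m) ^ q) * eulerProduct q (k ∷ ks) ≡
  fromℕ ((suc k *ℕ m) ^ q) * eulerProduct q ks - fromℕ (m ^ q) * eulerProduct q ks
power-eulerProduct k m q ks = begin
  fromℕ ((suc k *ℕ m) ^ q) * ((1ℚ - r) * E)   ≡⟨ cong (_* ((1ℚ - r) * E)) power ⟩
  P * M * ((1ℚ - r) * E)                       ≡⟨ solve 4 (λ P M r E → P :* M :* ((con 1ℚ :- r) :* E) := P :* M :* E :- (r :* P) :* (M :* E)) refl P M r E ⟩
  P * M * E - (r * P) * (M * E)                ≡⟨ cong (λ x → P * M * E - x * (M * E)) (1/n*n≡1 (suc k ^ q) {{ℕₚ.m^n≢0 (suc k) q}}) ⟩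
  P * M * E - 1ℚ * (M * E)                     ≡⟨ cong₂ (λ x y → x * E - y) (sym power) (ℚₚ.*-identityˡ (M * E)) ⟩
  fromℕ ((suc k *ℕ m) ^ q) * E - M * E        ∎
  where
  open ≡-Reasoning
  open ℚ-Solver
  E = eulerProduct q ks
  P = fromℕ (suc k ^ q)
  M = fromℕ (m ^ q)
  r = (+ 1 / (suc k ^ q)) {{ℕₚ.m^n≢0 (suc k) q}}
  power : fromℕ ((suc k *ℕ m) ^ q) ≡ P * M
  power = trans (cong fromℕ (^-distribʳ-* (suc k) m q)) (fromℕ-homo-* (suc k ^ q) (m ^ q))

∣prime⇒≡ : ∀ {p r} → Prime p → Prime r → r ∣ p → r ≡ p
∣prime⇒≡ pp pr r∣p with prime⇒irreducible pp r∣p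
... | inj₁ refl = contradiction pr ¬prime[1]
... | inj₂ r≡p  = r≡p

prime-∣-cofactor : ∀ {p r} m → Prime p → Prime r → p ≢ r → r ∣ p *ℕ m → r ∣ m
prime-∣-cofactor m pp pr p≢r r∣pm with euclidsLemma _ m pr r∣pm
... | inj₁ r∣p = contradiction (sym (∣prime⇒≡ pp pr r∣p)) p≢r
... | inj₂ r∣m = r∣m

-- `N ks n` is to be thought of as the count at `n` after removing the multiples of the primes in
-- `ks`. Induction on `ks`: the count and the Euler product obey the same recursion, and `φ`
-- commutes with the subtraction. The bound `M` is inherited by cofactors, so a base formula valid
-- only for small `n` can be sieved too, as `cψ≡0` does.
sieve : ∀ {φ} → Linear φ → (M : ℕ) (N : List ℕ → ℕ → ℚ) →
  (∀ n → .{{NonZero n}} → n ≤ M → N [] n ≡ φ (λ q → fromℕ (n ^ q))) →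
  (∀ k ks m → .{{NonZero m}} → Prime (suc k) → All (Prime ∘ suc) ks → All (k ≢_) ks →
    N (k ∷ ks) (suc k *ℕ m) ≡ N ks (suc k *ℕ m) - N ks m) →
  ∀ ks n → .{{NonZero n}} → n ≤ M → All (Prime ∘ suc) ks → All (λ k → suc k ∣ n) ks → Unique ks →
  N ks n ≡ φ (λ q → fromℕ (n ^ q) * eulerProduct q ks)
sieve L M N base step []       n n≤M _ _ _ =
  trans (base n n≤M) (ext L (λ q → sym (ℚₚ.*-identityʳ _)))
sieve {φ} L M N base step (k ∷ ks) n n≤M (pk ∷ pks) (divides m n≡ ∷ ks∣n) (k≢ks ∷ uks)
  rewrite trans n≡ (ℕₚ.*-comm m (suc k)) = begin
  N (k ∷ ks) n′                    ≡⟨ step k ks m pk pks k≢ks ⟩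
  N ks n′ - N ks m                 ≡⟨ cong₂ _-_ (sieve L M N base step ks n′ n≤M pks ks∣n uks)
                                                (sieve L M N base step ks m (ℕₚ.≤-trans (ℕₚ.m≤n*m m (suc k)) n≤M) pks ks∣m uks) ⟩
  φ (λ q → fromℕ (n′ ^ q) * eulerProduct q ks) - φ (λ q → fromℕ (m ^ q) * eulerProduct q ks)
                                   ≡⟨ homo-- L _ _ ⟨
  φ (λ q → fromℕ (n′ ^ q) * eulerProduct q ks - fromℕ (m ^ q) * eulerProduct q ks)
                                   ≡⟨ ext L (λ q → power-eulerProduct k m q ks) ⟨
  φ (λ q → fromℕ (n′ ^ q) * eulerProduct q (k ∷ ks)) ∎
  where
  open ≡-Reasoning
  n′ = suc k *ℕ m
  instance
    m≢0 : NonZero m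
    m≢0 = ℕₚ.m*n≢0⇒n≢0 (suc k)
  -- The primes are distinct, so those left in `ks` still divide the cofactor `m` after `suc k` has
  -- been split off.
  ks∣m : All (λ r → suc r ∣ m) ks
  ks∣m = All.zipWith (λ {r} ((pr , r∣n) , k≢r) → prime-∣-cofactor m pk pr (k≢r ∘ ℕₚ.suc-injective) r∣n)
           (All.zip (pks , ks∣n) , k≢ks)

-- Compositions and Stirling numbers.

-- Compositions of n into j positive parts: the first part of a composition of
-- suc n is either 1 or can be decreased.
compositions : ℕ → ℕ → ℕ
compositions zero    zero    = 1
compositions zero    (suc j) = 0
compositions (suc n) zero    = 0
compositions (suc n) (suc j) = compositions n j ℕ.+ compositions n (suc j)

-- For positive `n` and `j`, `compositions n j` is the binomial coefficient `(n − 1) C (j − 1)`, and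
-- this is the absorption identity `j (n C j) = n ((n − 1) C (j − 1))` with `n C j` split by
-- Pascal's rule. It serves to pass from `j` to `j + 1` parts.
compositions-absorb : ∀ n j → j *ℕ compositions n (suc j) ℕ.+ j *ℕ compositions n j ≡ n *ℕ compositions n j
compositions-absorb zero    zero          = refl
compositions-absorb zero    (suc j)       rewrite ℕₚ.*-zeroʳ j = refl
compositions-absorb (suc n) zero          = sym (ℕₚ.*-zeroʳ n)
compositions-absorb (suc n) (suc j)       = begin
  suc j *ℕ (b ℕ.+ c) ℕ.+ suc j *ℕ (a ℕ.+ b)
    ≡⟨ solve 4 (λ j a b c → (con 1 :+ j) :* (b :+ c) :+ (con 1 :+ j) :* (a :+ b)
                 := ((con 1 :+ j) :* c :+ (con 1 :+ j) :* b) :+ (j :* b :+ j :* a) :+ (a :+ b)) refl j a b c ⟩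
  (suc j *ℕ c ℕ.+ suc j *ℕ b) ℕ.+ (j *ℕ b ℕ.+ j *ℕ a) ℕ.+ (a ℕ.+ b)
    ≡⟨ cong₂ (λ x y → x ℕ.+ y ℕ.+ (a ℕ.+ b)) (compositions-absorb n (suc j)) (compositions-absorb n j) ⟩
  n *ℕ b ℕ.+ n *ℕ a ℕ.+ (a ℕ.+ b)
    ≡⟨ solve 3 (λ n a b → n :* b :+ n :* a :+ (a :+ b) := (con 1 :+ n) :* (a :+ b)) refl n a b ⟩
  suc n *ℕ (a ℕ.+ b) ∎
  where
  open ≡-Reasoning
  open ℕ-Solver
  a = compositions n j
  b = compositions n (suc j)
  c = compositions n (suc (suc j))

compositions-< : ∀ {n j} → n < j → compositions n j ≡ 0
compositions-< {zero}  {suc j} _         = refl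
compositions-< {suc n} {suc j} (s≤s n<j) = cong₂ ℕ._+_ (compositions-< n<j) (compositions-< (ℕₚ.m<n⇒m<1+n n<j))

compositions-1 : ∀ n .{{_ : NonZero n}} → compositions n 1 ≡ 1
compositions-1 (suc zero)    = refl
compositions-1 (suc (suc n)) = compositions-1 (suc n)

-- This is the product `(n − 1)(n − 2)⋯(n − j)`: the falling factorial of length `j + 1` in `n`,
-- expanded in powers and divided by `n`.
stirlingPolynomial : ℕ → ℕ → ℚ
stirlingPolynomial j n = Σ< (suc j) (λ i → fromℤ (s (suc j) (suc i)) * fromℕ (n ^ i))

-- The recurrence of `s` splits each coefficient in two: one part carries the factor `− (j + 1)`,
-- the other is the old polynomial shifted up by one power of `n`.
stirlingPolynomial-suc : ∀ j n →
  stirlingPolynomial (suc j) n ≡ (fromℕ n - fromℕ (suc j)) * stirlingPolynomial j n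
stirlingPolynomial-suc j n = begin
  Σ< (2 ℕ.+ j) (λ i → fromℤ (s (2 ℕ.+ j) (suc i)) * fromℕ (n ^ i))
    ≡⟨ Σ<-cong (2 ℕ.+ j) (λ i _ → term i) ⟩
  Σ< (2 ℕ.+ j) (λ i → c * f i + g i)
    ≡⟨ Σ<-+ (2 ℕ.+ j) (λ i → c * f i) g ⟩
  Σ< (2 ℕ.+ j) (λ i → c * f i) + Σ< (2 ℕ.+ j) g
    -- `g 0` has the coefficient `s (suc j) 0`, which is 0.
    ≡⟨ cong₂ _+_ (sym (*-Σ< c (2 ℕ.+ j) f)) (cong (_+ Σ< (suc j) (g ∘ suc)) (ℚₚ.*-zeroˡ (fromℕ 1))) ⟩
  c * Σ< (2 ℕ.+ j) f + (0ℚ + Σ< (suc j) (g ∘ suc))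
    ≡⟨ cong₂ (λ x y → c * x + y) last (trans (ℚₚ.+-identityˡ (Σ< (suc j) (g ∘ suc))) shift) ⟩
  c * P + fromℕ n * P
    ≡⟨ cong (λ x → x * P + fromℕ n * P) (fromℤ-homo-neg (+ suc j)) ⟩
  - fromℕ (suc j) * P + fromℕ n * P
    ≡⟨ solve 3 (λ a b P → :- a :* P :+ b :* P := (b :- a) :* P) refl (fromℕ (suc j)) (fromℕ n) P ⟩
  (fromℕ n - fromℕ (suc j)) * P ∎
  where
  open ≡-Reasoning
  open ℚ-Solver
  P = stirlingPolynomial j n
  c = fromℤ (ℤ.- + suc j)
  f g : ℕ → ℚ
  f i = fromℤ (s (suc j) (suc i)) * fromℕ (n ^ i)
  g i = fromℤ (s (suc j) i) * fromℕ (n ^ i)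
  term : ∀ i → fromℤ (s (2 ℕ.+ j) (suc i)) * fromℕ (n ^ i) ≡ c * f i + g i
  term i = trans (cong (_* fromℕ (n ^ i)) (trans
      (fromℤ-homo-+ (ℤ.- + suc j ℤ.* s (suc j) (suc i)) (s (suc j) i))
      (cong (_+ fromℤ (s (suc j) i)) (fromℤ-homo-* (ℤ.- + suc j) (s (suc j) (suc i))))))
    (solve 4 (λ c a b x → (c :* a :+ b) :* x := c :* (a :* x) :+ b :* x) refl
      c (fromℤ (s (suc j) (suc i))) (fromℤ (s (suc j) i)) (fromℕ (n ^ i)))
  -- The surplus top term has a coefficient above the diagonal, so `s-above` makes it vanish.
  last : Σ< (2 ℕ.+ j) f ≡ P
  last = begin
    Σ< (2 ℕ.+ j) f       ≡⟨ Σ<-last (suc j) f ⟩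
    P + f (suc j)        ≡⟨ cong (λ z → P + fromℤ z * fromℕ (n ^ suc j)) (s-above (ℕₚ.n<1+n (suc j))) ⟩
    P + 0ℚ * fromℕ (n ^ suc j) ≡⟨ solve 2 (λ P x → P :+ con 0ℚ :* x := P) refl P (fromℕ (n ^ suc j)) ⟩
    P                    ∎
  shift : Σ< (suc j) (g ∘ suc) ≡ fromℕ n * P
  shift = trans (Σ<-cong (suc j) (λ i _ → trans
      (cong (fromℤ (s (suc j) (suc i)) *_) (fromℕ-homo-* n (n ^ i)))
      (solve 3 (λ a n x → a :* (n :* x) := n :* (a :* x)) refl (fromℤ (s (suc j) (suc i))) (fromℕ n) (fromℕ (n ^ i)))))
    (sym (*-Σ< (fromℕ n) (suc j) f))

-- In the induction, `compositions-absorb` trades the new factor `n − (j + 1)` for `j + 1` and one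
-- more part. At `n = 0` and `j = 0` the equation would fail: `0 ^ 0` is 1, but 0 has no composition
-- into one part.
stirlingPolynomial≡ : ∀ j n .{{_ : NonZero n}} →
  stirlingPolynomial j n ≡ fromℕ (j !) * fromℕ (compositions n (suc j))
stirlingPolynomial≡ zero    n = cong (λ x → 1ℚ * fromℕ x) (sym (compositions-1 n))
stirlingPolynomial≡ (suc j) n = begin
  stirlingPolynomial (suc j) n            ≡⟨ stirlingPolynomial-suc j n ⟩
  (N - S) * stirlingPolynomial j n        ≡⟨ cong ((N - S) *_) (stirlingPolynomial≡ j n) ⟩
  (N - S) * (F * A)                       ≡⟨ solve 4 (λ N S F A → (N :- S) :* (F :* A) := F :* (N :* A :- S :* A)) refl N S F A ⟩
  F * (N * A - S * A)                     ≡⟨ cong (λ x → F * (x - S * A)) absorb ⟨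
  F * (S * A′ + S * A - S * A)             ≡⟨ solve 4 (λ S F A A′ → F :* (S :* A′ :+ S :* A :- S :* A) := S :* F :* A′) refl S F A A′ ⟩
  S * F * A′                               ≡⟨ cong (_* A′) (fromℕ-homo-* (suc j) (j !)) ⟨
  fromℕ (suc j !) * A′                     ∎
  where
  open ≡-Reasoning
  open ℚ-Solver
  N = fromℕ n
  S = fromℕ (suc j)
  F = fromℕ (j !)
  A = fromℕ (compositions n (suc j))
  A′ = fromℕ (compositions n (suc (suc j)))
  absorb : S * A′ + S * A ≡ N * A
  absorb = begin
    S * A′ + S * A   ≡⟨ cong₂ _+_ (fromℕ-homo-* (suc j) (compositions n (2 ℕ.+ j))) (fromℕ-homo-* (suc j) (compositions n (suc j))) ⟨
    fromℕ (suc j *ℕ compositions n (2 ℕ.+ j)) + fromℕ (suc j *ℕ compositions n (suc j))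
                     ≡⟨ fromℕ-homo-+ (suc j *ℕ compositions n (2 ℕ.+ j)) (suc j *ℕ compositions n (suc j)) ⟨
    fromℕ (suc j *ℕ compositions n (2 ℕ.+ j) ℕ.+ suc j *ℕ compositions n (suc j))
                     ≡⟨ cong fromℕ (compositions-absorb n (suc j)) ⟩
    fromℕ (n *ℕ compositions n (suc j))
                     ≡⟨ fromℕ-homo-* n (compositions n (suc j)) ⟩
    N * A            ∎

-- The formula for `cψ` with an arbitrary function in place of Jordan's totient:
-- `stirlingSum d (λ q → J q n)` is `cψ n d` by definition.
stirlingSum : ℕ → (ℕ → ℚ) → ℚ
stirlingSum d g = (+ 1 / ((d ∸ 1) !)) {{ℕₚ._!≢0 (d ∸ 1)}} *
                  ∑[ i from 1 to d ] (fromℤ (s d i) * g (i ∸ 1))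

stirlingSum-linear : ∀ d → Linear (stirlingSum d)
stirlingSum-linear d = 
  linear-* ((+ 1 / ((d ∸ 1) !)) {{ℕₚ._!≢0 (d ∸ 1)}})
    (linear-∑ 1 d (λ i → linear-* (fromℤ (s d i)) (linear-at (i ∸ 1))))

stirlingSum-powers : ∀ j n .{{_ : NonZero n}} →
  stirlingSum (suc j) (λ q → fromℕ (n ^ q)) ≡ fromℕ (compositions n (suc j))
stirlingSum-powers j n = begin
  r * ∑[ i from 1 to suc j ] (fromℤ (s (suc j) i) * fromℕ (n ^ (i ∸ 1)))
                        ≡⟨ cong (r *_) (∑≡Σ< 1 (suc j) (λ i → fromℤ (s (suc j) i) * fromℕ (n ^ (i ∸ 1)))) ⟩
  r * stirlingPolynomial j n ≡⟨ cong (r *_) (stirlingPolynomial≡ j n) ⟩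
  r * (fromℕ (j !) * A) ≡⟨ ℚₚ.*-assoc r (fromℕ (j !)) A ⟨
  r * fromℕ (j !) * A   ≡⟨ cong (_* A) (1/n*n≡1 (j !) {{ℕₚ._!≢0 j}}) ⟩
  1ℚ * A                ≡⟨ ℚₚ.*-identityˡ A ⟩
  A                     ∎
  where
  open ≡-Reasoning
  r = (+ 1 / (j !)) {{ℕₚ._!≢0 j}}
  A = fromℕ (compositions n (suc j))

-- Sign patterns and the functional that counts points of a given norm.

-- The sum over the sign patterns in {−, 0, +}ᵈ of g at the number of non-zero signs.
signedSum : ℕ → (ℕ → ℕ) → ℕ
signedSum zero    g = g 0
signedSum (suc d) g = signedSum d g ℕ.+ 2 *ℕ signedSum d (g ∘ suc)

signedSum-+ : ∀ d f g → signedSum d (λ j → f j ℕ.+ g j) ≡ signedSum d f ℕ.+ signedSum d g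
signedSum-+ zero    f g = refl
signedSum-+ (suc d) f g rewrite signedSum-+ d f g | signedSum-+ d (f ∘ suc) (g ∘ suc) =
  solve 4 (λ a b c d → a :+ b :+ con 2 :* (c :+ d) := a :+ con 2 :* c :+ (b :+ con 2 :* d)) refl
    (signedSum d f) (signedSum d g) (signedSum d (f ∘ suc)) (signedSum d (g ∘ suc))
  where open ℕ-Solver

-- There are `d C j` ways to place `j` non-zero signs and `2 ^ j` ways to choose them. The induction
-- on `d` is Pascal's rule, the factor 2 being the choice of a non-zero first sign.
signedSum-binomial : ∀ d g →
  fromℕ (signedSum d g) ≡ Σ< (suc d) (λ j → fromℕ ((2 ^ j) *ℕ (d C j)) * fromℕ (g j))
signedSum-binomial zero    g = solve 1 (λ x → x := con 1ℚ :* x :+ con 0ℚ) refl (fromℕ (g 0))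
  where open ℚ-Solver
signedSum-binomial (suc d) g = begin
  fromℕ (signedSum d g ℕ.+ 2 *ℕ signedSum d (g ∘ suc))
    ≡⟨ trans (fromℕ-homo-+ (signedSum d g) (2 *ℕ signedSum d (g ∘ suc)))
         (cong₂ _+_ (signedSum-binomial d g)
           (trans (fromℕ-homo-* 2 (signedSum d (g ∘ suc)))
             (cong (fromℕ 2 *_) (signedSum-binomial d (g ∘ suc))))) ⟩
  (h 0 + Σ< d (h ∘ suc)) + fromℕ 2 * Σ< (suc d) h′
    ≡⟨ cong (λ x → (h 0 + x) + fromℕ 2 * Σ< (suc d) h′) extend ⟨
  (h 0 + Σ< (suc d) (h ∘ suc)) + fromℕ 2 * Σ< (suc d) h′
    ≡⟨ cong (λ x → (h 0 + Σ< (suc d) (h ∘ suc)) + x) (*-Σ< (fromℕ 2) (suc d) h′) ⟩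
  (h 0 + Σ< (suc d) (h ∘ suc)) + Σ< (suc d) (λ j → fromℕ 2 * h′ j)
    ≡⟨ solve 3 (λ a b c → a :+ b :+ c := a :+ (c :+ b)) refl (h 0) (Σ< (suc d) (h ∘ suc)) (Σ< (suc d) (λ j → fromℕ 2 * h′ j)) ⟩
  h 0 + (Σ< (suc d) (λ j → fromℕ 2 * h′ j) + Σ< (suc d) (h ∘ suc))
    ≡⟨ cong (_+_ (h 0)) (trans (sym (Σ<-+ (suc d) (λ j → fromℕ 2 * h′ j) (h ∘ suc)))
         (Σ<-cong (suc d) (λ j _ → sym (pascal j)))) ⟩
  Σ< (2 ℕ.+ d) (λ j → fromℕ ((2 ^ j) *ℕ (suc d C j)) * fromℕ (g j)) ∎
  where
  open ≡-Reasoning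
  open ℚ-Solver
  h h′ : ℕ → ℚ
  h  j = fromℕ ((2 ^ j) *ℕ (d C j)) * fromℕ (g j)
  h′ j = fromℕ ((2 ^ j) *ℕ (d C j)) * fromℕ (g (suc j))
  -- `d C suc d` is 0, so both sums can be given the same length before they are added term by term.
  extend : Σ< (suc d) (h ∘ suc) ≡ Σ< d (h ∘ suc)
  extend = begin
    Σ< (suc d) (h ∘ suc)          ≡⟨ Σ<-last d (h ∘ suc) ⟩
    Σ< d (h ∘ suc) + h (suc d)    ≡⟨ cong (λ x → Σ< d (h ∘ suc) + fromℕ x * fromℕ (g (suc d)))
                                       (trans (cong ((2 ^ suc d) *ℕ_) (k>n⇒nCk≡0 (ℕₚ.n<1+n d))) (ℕₚ.*-zeroʳ (2 ^ suc d))) ⟩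
    Σ< d (h ∘ suc) + 0ℚ * fromℕ (g (suc d))
                                  ≡⟨ solve 2 (λ a b → a :+ con 0ℚ :* b := a) refl (Σ< d (h ∘ suc)) (fromℕ (g (suc d))) ⟩
    Σ< d (h ∘ suc)                ∎
  pascal : ∀ j → fromℕ ((2 ^ suc j) *ℕ (suc d C suc j)) * fromℕ (g (suc j)) ≡ fromℕ 2 * h′ j + h (suc j)
  pascal j = begin
    fromℕ ((2 ^ suc j) *ℕ (suc d C suc j)) * G
      ≡⟨ cong (λ x → fromℕ ((2 ^ suc j) *ℕ x) * G) (nCk+nC[k+1]≡[n+1]C[k+1] d j) ⟨
    fromℕ ((2 ^ suc j) *ℕ (d C j ℕ.+ d C suc j)) * G
      ≡⟨ cong (λ x → fromℕ x * G) (distrib (2 ^ j) (d C j) (d C suc j)) ⟩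
    fromℕ (2 *ℕ (2 ^ j *ℕ (d C j)) ℕ.+ 2 ^ suc j *ℕ (d C suc j)) * G
      ≡⟨ cong (_* G) (trans (fromℕ-homo-+ (2 *ℕ (2 ^ j *ℕ (d C j))) (2 ^ suc j *ℕ (d C suc j)))
           (cong (_+ fromℕ (2 ^ suc j *ℕ (d C suc j))) (fromℕ-homo-* 2 (2 ^ j *ℕ (d C j))))) ⟩
    (fromℕ 2 * fromℕ (2 ^ j *ℕ (d C j)) + fromℕ (2 ^ suc j *ℕ (d C suc j))) * G
      ≡⟨ solve 4 (λ a b c G → (a :* b :+ c) :* G := a :* (b :* G) :+ c :* G) refl
           (fromℕ 2) (fromℕ (2 ^ j *ℕ (d C j))) (fromℕ (2 ^ suc j *ℕ (d C suc j))) G ⟩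
    fromℕ 2 * h′ j + h (suc j) ∎
    where
    G = fromℕ (g (suc j))
    distrib : ∀ a b c → 2 *ℕ a *ℕ (b ℕ.+ c) ≡ 2 *ℕ (a *ℕ b) ℕ.+ 2 *ℕ a *ℕ c
    distrib = S.solve 3 (λ a b c → S.con 2 S.:* a S.:* (b S.:+ c) S.:= S.con 2 S.:* (a S.:* b) S.:+ S.con 2 S.:* a S.:* c) refl
      where module S = ℕ-Solver

-- At `q ↦ n ^ q` this yields the number of all points of norm `n > 0`; at `q ↦ J q n` it yields the
-- number of primitive ones.
sphereFunctional : ℕ → (ℕ → ℚ) → ℚ
sphereFunctional d g = ∑[ j from 1 to d ] (fromℕ ((2 ^ j) *ℕ (d C j)) * stirlingSum j g)

sphereFunctional-linear : ∀ d → Linear (sphereFunctional d)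
sphereFunctional-linear d = linear-∑ 1 d (λ j → linear-* (fromℕ ((2 ^ j) *ℕ (d C j))) (stirlingSum-linear j))

sphereFunctional-powers : ∀ d n .{{_ : NonZero n}} →
  fromℕ (signedSum d (compositions n)) ≡ sphereFunctional d (λ q → fromℕ (n ^ q))
sphereFunctional-powers d n@(suc _) = begin
  fromℕ (signedSum d (compositions n))   ≡⟨ signedSum-binomial d (compositions n) ⟩
  -- The term for `j = 0` is 0 because a positive `n` has no composition into zero parts; matching
  -- on `suc` lets this compute.
  1ℚ * 0ℚ + Σ< d (λ j → c (suc j) * fromℕ (compositions n (suc j)))
                                         ≡⟨ ℚₚ.+-identityˡ (Σ< d (λ j → c (suc j) * fromℕ (compositions n (suc j)))) ⟩
  Σ< d (λ j → c (suc j) * fromℕ (compositions n (suc j)))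
                                         ≡⟨ Σ<-cong d (λ j _ → cong (c (suc j) *_) (sym (stirlingSum-powers j n))) ⟩
  Σ< d (λ j → c (suc j) * stirlingSum (suc j) (λ q → fromℕ (n ^ q)))
                                         ≡⟨ ∑≡Σ< 1 d (λ j → c j * stirlingSum j (λ q → fromℕ (n ^ q))) ⟨
  sphereFunctional d (λ q → fromℕ (n ^ q)) ∎
  where
  open ≡-Reasoning
  c : ℕ → ℚ
  c j = fromℕ ((2 ^ j) *ℕ (d C j))

-- Jordan's totient as the result of the sieve.

predPrimeDivisor? : ∀ n → Decidable (λ k → Prime (suc k) × suc k ∣ n)
predPrimeDivisor? n k = prime? (suc k) ×-dec (suc k ∣? n)

-- Repeats the list local to `J`, so that `fromℕ (n ^ q) * eulerProduct q (predPrimeDivisors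
-- n)` and `J q n` agree by definition.
predPrimeDivisors : ℕ → List ℕ
predPrimeDivisors n = filter (predPrimeDivisor? n) (upTo n)

predPrimeDivisors-prime : ∀ n → All (Prime ∘ suc) (predPrimeDivisors n)
predPrimeDivisors-prime n = All.map proj₁ (Allₚ.all-filter (predPrimeDivisor? n) (upTo n))

predPrimeDivisors-∣ : ∀ n → All (λ k → suc k ∣ n) (predPrimeDivisors n)
predPrimeDivisors-∣ n = All.map proj₂ (Allₚ.all-filter (predPrimeDivisor? n) (upTo n))

predPrimeDivisors-unique : ∀ n → Unique (predPrimeDivisors n)
predPrimeDivisors-unique n = Uniqueₚ.filter⁺ (predPrimeDivisor? n) (Uniqueₚ.upTo⁺ n)

sieve-J : ∀ {φ} → Linear φ → (n : ℕ) .{{_ : NonZero n}} (N : List ℕ → ℕ → ℚ) →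
  (∀ m → .{{NonZero m}} → m ≤ n → N [] m ≡ φ (λ q → fromℕ (m ^ q))) →
  (∀ k ks m → .{{NonZero m}} → Prime (suc k) → All (Prime ∘ suc) ks → All (k ≢_) ks →
    N (k ∷ ks) (suc k *ℕ m) ≡ N ks (suc k *ℕ m) - N ks m) →
  N (predPrimeDivisors n) n ≡ φ (λ q → J q n)
sieve-J L n N base step = sieve L n N base step (predPrimeDivisors n) n ℕₚ.≤-refl
  (predPrimeDivisors-prime n) (predPrimeDivisors-∣ n) (predPrimeDivisors-unique n)

-- No `m ≤ n` has a composition into more than `n` parts, so the unsieved counts up to the bound `n`
-- are all 0, and sieving zeros leaves 0.
cψ≡0 : ∀ n j .{{_ : NonZero n}} → n < j → cψ n j ≡ 0ℚ
cψ≡0 n (suc j) n<j = sym (sieve-J (stirlingSum-linear (suc j)) n (λ _ _ → 0ℚ)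
  (λ m m≤n → sym (trans (stirlingSum-powers j m) (cong fromℕ (compositions-< (ℕₚ.≤-<-trans m≤n n<j)))))
  (λ _ _ _ _ _ _ → refl))

-- After exchanging the sums over the norm and over `j`, the terms with `i < j` are dropped by
-- `cψ≡0`. Index `k` stands for the norm `suc k`.
Σ<-sphereFunctional : ∀ d p (w : ℕ → ℚ) →
  Σ< p (λ k → w (suc k) * sphereFunctional d (λ q → J q (suc k))) ≡
  ∑[ j from 1 to d ] (fromℕ ((2 ^ j) *ℕ (d C j)) * ∑[ i from j to p ] (w i * cψ i j))
Σ<-sphereFunctional d p w = begin
  Σ< p (λ k → w (suc k) * sphereFunctional d (λ q → J q (suc k)))
    ≡⟨ Σ<-cong p (λ k _ → trans (cong (w (suc k) *_) (∑≡Σ< 1 d (λ j → c j * cψ (suc k) j)))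
                                (*-Σ< (w (suc k)) d (λ j → c (suc j) * cψ (suc k) (suc j)))) ⟩
  Σ< p (λ k → Σ< d (λ j → w (suc k) * (c (suc j) * cψ (suc k) (suc j))))
    ≡⟨ Σ<-swap p d (λ k j → w (suc k) * (c (suc j) * cψ (suc k) (suc j))) ⟩
  Σ< d (λ j → Σ< p (λ k → w (suc k) * (c (suc j) * cψ (suc k) (suc j))))
    ≡⟨ Σ<-cong d (λ j _ → term j) ⟩
  Σ< d (λ j → c (suc j) * ∑[ i from suc j to p ] (w i * cψ i (suc j)))
    ≡⟨ ∑≡Σ< 1 d (λ j → c j * ∑[ i from j to p ] (w i * cψ i j)) ⟨
  ∑[ j from 1 to d ] (c j * ∑[ i from j to p ] (w i * cψ i j)) ∎
  where
  open ≡-Reasoning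
  c : ℕ → ℚ
  c j = fromℕ ((2 ^ j) *ℕ (d C j))
  term : ∀ j → Σ< p (λ k → w (suc k) * (c (suc j) * cψ (suc k) (suc j))) ≡
               c (suc j) * ∑[ i from suc j to p ] (w i * cψ i (suc j))
  term j = begin
    Σ< p (λ k → w (suc k) * (c (suc j) * cψ (suc k) (suc j)))
      ≡⟨ Σ<-cong p (λ k _ → solve 3 (λ w c x → w :* (c :* x) := c :* (w :* x))
                              refl (w (suc k)) (c (suc j)) (cψ (suc k) (suc j))) ⟩
    Σ< p (λ k → c (suc j) * f k)
      ≡⟨ *-Σ< (c (suc j)) p f ⟨
    c (suc j) * Σ< p f
      ≡⟨ cong (c (suc j) *_) (Σ<-drop j p f (λ k k<j _ →
           trans (cong (w (suc k) *_) (cψ≡0 (suc k) (suc j) (s≤s k<j))) (ℚₚ.*-zeroʳ (w (suc k))))) ⟨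
    c (suc j) * Σ< (p ∸ j) (λ k → f (j ℕ.+ k))
      ≡⟨ cong (c (suc j) *_) (∑≡Σ< (suc j) p (λ i → w i * cψ i (suc j))) ⟨
    c (suc j) * ∑[ i from suc j to p ] (w i * cψ i (suc j)) ∎
    where
    open ℚ-Solver
    f : ℕ → ℚ
    f k = w (suc k) * cψ (suc k) (suc j)

-- Enumerations of finite sets: constructions, counts and weighted totals.

open Enumeration

private variable
  a ℓ ℓ′ ℓ″ : Level
  A A′ : Set a
  P : Pred A ℓ
  Q : Pred A ℓ′
  R : Pred A ℓ″

∈⇒ : (X : Enumeration P) → ∀ {x} → x ∈ elements X → P x
∈⇒ X = Equivalence.to (∈⇔ X)

⇒∈ : (X : Enumeration P) → ∀ {x} → P x → x ∈ elements X
⇒∈ X = Equivalence.from (∈⇔ X)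

empty : (∀ {x} → ¬ P x) → Enumeration P
empty ¬P = record { elements = [] ; unique = [] ; ∈⇔ = mk⇔ (λ ()) (λ Px → contradiction Px ¬P) }

singleton : ∀ x → P x → (∀ {y} → P y → y ≡ x) → Enumeration P
singleton x Px P⇒≡ = record
  { elements = x ∷ []
  ; unique   = [] ∷ []
  ; ∈⇔       = mk⇔ (λ { (here refl) → Px }) (here ∘ P⇒≡)
  }

relabel : (∀ {x} → P x → Q x) → (∀ {x} → Q x → P x) → Enumeration P → Enumeration Q
relabel P⇒Q Q⇒P X = record
  { elements = elements X
  ; unique   = unique X
  ; ∈⇔       = mk⇔ (P⇒Q ∘ ∈⇒ X) (⇒∈ X ∘ Q⇒P)
  }

-- The list is a plain concatenation, so that counts and totals over a partition split by the laws
-- for `++`.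
union : (∀ {x} → P x → R x) → (∀ {x} → Q x → R x) → (∀ {x} → R x → P x ⊎ Q x) →
        (∀ {x} → P x → Q x → ⊥) → Enumeration P → Enumeration Q → Enumeration R
union P⇒R Q⇒R split disjoint X Y = record
  { elements = elements X ++ elements Y
  ; unique   = Uniqueₚ.++⁺ (unique X) (unique Y) (λ (x∈X , x∈Y) → disjoint (∈⇒ X x∈X) (∈⇒ Y x∈Y))
  ; ∈⇔       = mk⇔
      (λ x∈ → [ P⇒R ∘ ∈⇒ X , Q⇒R ∘ ∈⇒ Y ]′ (∈-++⁻ (elements X) x∈))
      (λ Rx → [ ∈-++⁺ˡ ∘ ⇒∈ X , ∈-++⁺ʳ (elements X) ∘ ⇒∈ Y ]′ (split Rx))
  }

image : (f : A → A′) → (∀ {x y} → f x ≡ f y → x ≡ y) →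
        {P : Pred A ℓ} {Q : Pred A′ ℓ′} →
        (∀ {x} → P x → Q (f x)) → (∀ {y} → Q y → ∃ λ x → P x × f x ≡ y) →
        Enumeration P → Enumeration Q
image f f-injective {Q = Q} P⇒Q Q⇒P X = record
  { elements = map f (elements X)
  ; unique   = Uniqueₚ.map⁺ f-injective (unique X)
  ; ∈⇔       = mk⇔
      (λ y∈ → let x , x∈ , y≡fx = ∈-map⁻ f y∈ in subst Q (sym y≡fx) (P⇒Q (∈⇒ X x∈)))
      (λ Qy → let x , Px , fx≡y = Q⇒P Qy in subst (_∈ map f (elements X)) fx≡y (∈-map⁺ f (⇒∈ X Px)))
  }

restrict : Decidable Q → Enumeration P → Enumeration (P ∩ Q)
restrict Q? X = record
  { elements = filter Q? (elements X)
  ; unique   = Uniqueₚ.filter⁺ Q? (unique X)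
  ; ∈⇔       = mk⇔
      (λ x∈ → let x∈X , Qx = ∈-filter⁻ Q? {xs = elements X} x∈ in ∈⇒ X x∈X , Qx)
      (λ (Px , Qx) → ∈-filter⁺ Q? (⇒∈ X Px) Qx)
  }

-- Lists without repetition that have the same members are permutations of each other. Counts and
-- totals therefore depend on the predicate alone, and a given enumeration can be exchanged for a
-- convenient one.
elements-↭ : (X Y : Enumeration P) → elements X ↭ elements Y
elements-↭ X Y = ∼bag⇒↭ (unique∧set⇒bag (unique X) (unique Y) (mk⇔ (⇒∈ Y ∘ ∈⇒ X) (⇒∈ X ∘ ∈⇒ Y)))

card-≡ : (X Y : Enumeration P) → card X ≡ card Y
card-≡ X Y = ↭ₚ.↭-length (elements-↭ X Y)

total : (A → ℕ) → {P : Pred A ℓ} → Enumeration P → ℕ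
total w X = sum (map w (elements X))

total-≡ : (w : A → ℕ) {P : Pred A ℓ} (X Y : Enumeration P) → total w X ≡ total w Y
total-≡ w X Y = sum-↭ (↭ₚ.map⁺ w (elements-↭ X Y))

sum-map-++ : (w : A → ℕ) (xs ys : List A) → sum (map w (xs ++ ys)) ≡ sum (map w xs) ℕ.+ sum (map w ys)
sum-map-++ w xs ys = trans (cong sum (Listₚ.map-++ w xs ys)) (sum-++ (map w xs) (map w ys))

sum-map-map : (w : A′ → ℕ) (f : A → A′) {v : A → ℕ} → (∀ x → w (f x) ≡ v x) →
              (xs : List A) → sum (map w (map f xs)) ≡ sum (map v xs)
sum-map-map w f wf≗v xs = cong sum (trans (sym (Listₚ.map-∘ xs)) (Listₚ.map-cong wf≗v xs))

sum-map-const : (w : A → ℕ) (c : ℕ) (xs : List A) → (∀ {x} → x ∈ xs → w x ≡ c) →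
                sum (map w xs) ≡ c *ℕ length xs
sum-map-const w c xs w≡c = go xs (All.tabulate w≡c)
  where
  go : ∀ xs → All (λ x → w x ≡ c) xs → sum (map w xs) ≡ c *ℕ length xs
  go []       []         = sym (ℕₚ.*-zeroʳ c)
  go (x ∷ xs) (eq ∷ eqs) = trans (cong₂ ℕ._+_ eq (go xs eqs)) (sym (ℕₚ.*-suc c (length xs)))

-- Norm and content under negation and scaling.

content : ∀ {d} → ℤ^ d → ℕ
content x = Vec.foldr′ gcd 0 (Vec.map ∣_∣ x)

-- The reason why only the prime divisors of the norm have to be sieved out.
content-∣-norm : ∀ {d} (x : ℤ^ d) → content x ∣ ‖ x ‖₁
content-∣-norm []      = ∣-refl
content-∣-norm (z ∷ x) = ∣m∣n⇒∣m+n (gcd[m,n]∣m ∣ z ∣ (content x))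
                                   (∣-trans (gcd[m,n]∣n ∣ z ∣ (content x)) (content-∣-norm x))

norm≡0⇒content≡0 : ∀ {d} (x : ℤ^ d) → ‖ x ‖₁ ≡ 0 → content x ≡ 0
norm≡0⇒content≡0 []      _  = refl
norm≡0⇒content≡0 (z ∷ x) eq =
  cong₂ gcd (ℕₚ.m+n≡0⇒m≡0 ∣ z ∣ eq) (norm≡0⇒content≡0 x (ℕₚ.m+n≡0⇒n≡0 ∣ z ∣ eq))

map-injective : {f : A → A′} → (∀ {x y} → f x ≡ f y → x ≡ y) →
                ∀ {n} {xs ys : Vec A n} → Vec.map f xs ≡ Vec.map f ys → xs ≡ ys
map-injective f-inj {xs = []}     {[]}     _  = refl
map-injective f-inj {xs = x ∷ xs} {y ∷ ys} eq =
  cong₂ _∷_ (f-inj (Vecₚ.∷-injectiveˡ eq)) (map-injective f-inj (Vecₚ.∷-injectiveʳ eq))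

negate : ∀ {d} → ℤ^ d → ℤ^ d
negate = Vec.map neg

negate-involutive : ∀ {d} (x : ℤ^ d) → negate (negate x) ≡ x
negate-involutive []      = refl
negate-involutive (z ∷ x) = cong₂ _∷_ (ℤₚ.neg-involutive z) (negate-involutive x)

negate-injective : ∀ {d} {x y : ℤ^ d} → negate x ≡ negate y → x ≡ y
negate-injective = map-injective ℤₚ.neg-injective

abs-negate : ∀ {d} (x : ℤ^ d) → Vec.map ∣_∣ (negate x) ≡ Vec.map ∣_∣ x
abs-negate []      = refl
abs-negate (z ∷ x) = cong₂ _∷_ (ℤₚ.∣-i∣≡∣i∣ z) (abs-negate x)

norm-negate : ∀ {d} (x : ℤ^ d) → ‖ negate x ‖₁ ≡ ‖ x ‖₁
norm-negate x = cong Vec.sum (abs-negate x)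

content-negate : ∀ {d} (x : ℤ^ d) → content (negate x) ≡ content x
content-negate x = cong (Vec.foldr′ gcd 0) (abs-negate x)

scale : ∀ {d} → ℕ → ℤ^ d → ℤ^ d
scale p = Vec.map (+ p ℤ.*_)

scale-injective : ∀ {d} p .{{_ : NonZero p}} {x y : ℤ^ d} → scale p x ≡ scale p y → x ≡ y
scale-injective p@(suc _) = map-injective (ℤₚ.*-cancelˡ-≡ (+ p) _ _)

norm-scale : ∀ {d} p (x : ℤ^ d) → ‖ scale p x ‖₁ ≡ p *ℕ ‖ x ‖₁
norm-scale p []      = sym (ℕₚ.*-zeroʳ p)
norm-scale p (z ∷ x) = trans (cong₂ ℕ._+_ (ℤₚ.abs-* (+ p) z) (norm-scale p x))
                             (sym (ℕₚ.*-distribˡ-+ p ∣ z ∣ ‖ x ‖₁))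

content-scale : ∀ {d} p (x : ℤ^ d) → content (scale p x) ≡ p *ℕ content x
content-scale p []      = sym (ℕₚ.*-zeroʳ p)
content-scale p (z ∷ x) = trans (cong₂ gcd (ℤₚ.abs-* (+ p) z) (content-scale p x))
                                (sym (c*gcd[m,n]≡gcd[cm,cn] p ∣ z ∣ (content x)))

∣abs⇒multiple : ∀ {p} z → p ∣ ∣ z ∣ → ∃ λ y → + p ℤ.* y ≡ z
∣abs⇒multiple {p} (+ n) (divides q n≡q*p) = + q ,
  trans (sym (ℤₚ.pos-* p q)) (cong +_ (trans (ℕₚ.*-comm p q) (sym n≡q*p)))
∣abs⇒multiple {p} -[1+ n ] (divides q n≡q*p) = ℤ.- + q ,
  trans (sym (ℤₚ.neg-distribʳ-* (+ p) (+ q)))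
        (cong neg (trans (sym (ℤₚ.pos-* p q)) (cong +_ (trans (ℕₚ.*-comm p q) (sym n≡q*p)))))

∣content⇒scale : ∀ {d p} (x : ℤ^ d) → p ∣ content x → ∃ λ y → scale p y ≡ x
∣content⇒scale []      _ = [] , refl
∣content⇒scale (z ∷ x) p∣ =
  let w , pw≡z = ∣abs⇒multiple z (∣-trans p∣ (gcd[m,n]∣m ∣ z ∣ (content x)))
      y , py≡x = ∣content⇒scale x (∣-trans p∣ (gcd[m,n]∣n ∣ z ∣ (content x)))
  in w ∷ y , cong₂ _∷_ pw≡z py≡x

-- Counting the integer points of a given norm.

Sphere : (d n : ℕ) → Pred (ℤ^ d) _
Sphere d n x = ‖ x ‖₁ ≡ n

Sphere⁺ : (d n : ℕ) → Pred (ℤ^ (suc d)) _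
Sphere⁺ d n x = 0ℤ ℤ.< head x × ‖ x ‖₁ ≡ n

incrementHead : ∀ {d} → ℤ^ (suc d) → ℤ^ (suc d)
incrementHead (z ∷ x) = ℤ.suc z ∷ x

incrementHead-injective : ∀ {d} {x y : ℤ^ (suc d)} → incrementHead x ≡ incrementHead y → x ≡ y
incrementHead-injective {x = w ∷ x} {z ∷ y} eq =
  cong₂ _∷_ (trans (sym (ℤₚ.pred-suc w)) (trans (cong ℤ.pred (Vecₚ.∷-injectiveˡ eq)) (ℤₚ.pred-suc z))) (Vecₚ.∷-injectiveʳ eq)

mutual
  -- Three classes by the sign of the head. The points with negative head are the negatives, in all
  -- coordinates, of those with positive head.
  sphere : ∀ d n → Enumeration (Sphere d n)
  sphere zero    zero    = singleton [] refl (λ { {[]} _ → refl })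
  sphere zero    (suc n) = empty (λ { {[]} () })
  sphere (suc d) n = union {P = λ x → head x ≡ 0ℤ × ‖ x ‖₁ ≡ n} {Q = λ x → head x ≢ 0ℤ × ‖ x ‖₁ ≡ n}
    proj₂ proj₂ (λ {x} → split {x}) (λ (z≡0 , _) (z≢0 , _) → z≢0 z≡0)
    (image (0ℤ ∷_) Vecₚ.∷-injectiveʳ (refl ,_) (λ { {_ ∷ x} (refl , eq) → x , eq , refl }) (sphere d n))
    (union {P = Sphere⁺ d n} {Q = λ x → head x ℤ.< 0ℤ × ‖ x ‖₁ ≡ n}
      (λ (0<z , eq) → ≢-sym (ℤₚ.<⇒≢ 0<z) , eq) (λ (z<0 , eq) → ℤₚ.<⇒≢ z<0 , eq) (λ {x} → split′ {x})
      (λ (0<z , _) (z<0 , _) → ℤₚ.<-asym 0<z z<0)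
      (sphere⁺ d n)
      (image negate negate-injective
        (λ { {z ∷ x} (0<z , eq) → ℤₚ.neg-mono-< 0<z , trans (norm-negate (z ∷ x)) eq })
        (λ { {z ∷ x} (z<0 , eq) → negate (z ∷ x) , (ℤₚ.neg-mono-< z<0 , trans (norm-negate (z ∷ x)) eq) , negate-involutive (z ∷ x) })
        (sphere⁺ d n)))
    where
    split : ∀ {x : ℤ^ (suc d)} → ‖ x ‖₁ ≡ n → (head x ≡ 0ℤ × ‖ x ‖₁ ≡ n) ⊎ (head x ≢ 0ℤ × ‖ x ‖₁ ≡ n)
    split {+0       ∷ x} eq = inj₁ (refl , eq)
    split {+[1+ _ ] ∷ x} eq = inj₂ ((λ ()) , eq)
    split { -[1+ _ ] ∷ x} eq = inj₂ ((λ ()) , eq)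
    split′ : ∀ {x : ℤ^ (suc d)} → head x ≢ 0ℤ × ‖ x ‖₁ ≡ n → Sphere⁺ d n x ⊎ (head x ℤ.< 0ℤ × ‖ x ‖₁ ≡ n)
    split′ {+0       ∷ x} (z≢0 , eq) = contradiction refl z≢0
    split′ {+[1+ _ ] ∷ x} (_ , eq) = inj₁ (+<+ (s≤s z≤n) , eq)
    split′ { -[1+ _ ] ∷ x} (_ , eq) = inj₂ (ℤ.-<+ , eq)

  -- The positive head is treated like the first part of a composition: it is 1, or it can be
  -- decreased and stays positive.
  sphere⁺ : ∀ d n → Enumeration (Sphere⁺ d n)
  sphere⁺ d zero    = empty (λ { {+[1+ _ ] ∷ x} (_ , ()) ; {+0 ∷ x} (+<+ () , _) })
  sphere⁺ d (suc n) = union {P = λ x → head x ≡ + 1 × ‖ x ‖₁ ≡ suc n} {Q = λ x → + 1 ℤ.< head x × ‖ x ‖₁ ≡ suc n}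
    (λ { {_ ∷ x} (refl , eq) → +<+ (s≤s z≤n) , eq }) (λ (1<z , eq) → ℤₚ.<-trans (+<+ (s≤s z≤n)) 1<z , eq)
    (λ { {+0 ∷ x}           (+<+ () , _)
       ; {+[1+ 0 ] ∷ x}     (_ , eq) → inj₁ (refl , eq)
       ; {+[1+ suc _ ] ∷ x} (_ , eq) → inj₂ (+<+ (s≤s (s≤s z≤n)) , eq) })
    (λ (z≡1 , _) (1<z , _) → ℤₚ.<⇒≢ 1<z (sym z≡1))
    (image (+ 1 ∷_) Vecₚ.∷-injectiveʳ (λ eq → refl , cong suc eq)
      (λ { {_ ∷ x} (refl , eq) → x , ℕₚ.suc-injective eq , refl }) (sphere d n))
    (image incrementHead incrementHead-injective
      (λ { {+0 ∷ x} (+<+ () , _)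
         ; {+[1+ k ] ∷ x} (_ , eq) → +<+ (s≤s (s≤s z≤n)) , cong suc eq })
      (λ { {+0 ∷ x} (+<+ () , _)
         ; {+[1+ 0 ] ∷ x} (+<+ (s≤s ()) , _)
         ; {+[1+ suc k ] ∷ x} (_ , eq) → +[1+ k ] ∷ x , (+<+ (s≤s z≤n) , ℕₚ.suc-injective eq) , refl })
      (sphere⁺ d n))

mutual
  -- The classes of `sphere` match the recursion of `signedSum`: a zero head consumes no part, and
  -- each of the two non-zero signs consumes one, hence the `suc` in `card-sphere⁺`.
  card-sphere : ∀ d n → card (sphere d n) ≡ signedSum d (compositions n)
  card-sphere zero    zero    = refl
  card-sphere zero    (suc n) = refl
  card-sphere (suc d) n = begin
    length (map (0ℤ ∷_) zs ++ ps ++ map negate ps)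
      ≡⟨ trans (Listₚ.length-++ (map (0ℤ ∷_) zs)) (cong₂ ℕ._+_ (Listₚ.length-map (0ℤ ∷_) zs)
           (trans (Listₚ.length-++ ps) (cong (length ps ℕ.+_) (Listₚ.length-map negate ps)))) ⟩
    length zs ℕ.+ (length ps ℕ.+ length ps)
      ≡⟨ cong₂ (λ a b → a ℕ.+ (b ℕ.+ b)) (card-sphere d n) (card-sphere⁺ d n) ⟩
    signedSum d (compositions n) ℕ.+ (P⁺ ℕ.+ P⁺)
      ≡⟨ cong (λ x → signedSum d (compositions n) ℕ.+ (P⁺ ℕ.+ x)) (ℕₚ.+-identityʳ P⁺) ⟨
    signedSum (suc d) (compositions n) ∎
    where
    open ≡-Reasoning
    zs = elements (sphere d n)
    ps = elements (sphere⁺ d n)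
    P⁺ = signedSum d (compositions n ∘ suc)

  card-sphere⁺ : ∀ d n → card (sphere⁺ d n) ≡ signedSum d (compositions n ∘ suc)
  card-sphere⁺ d zero    = sym (signedSum-zero d)
    where
    signedSum-zero : ∀ d → signedSum d (λ _ → 0) ≡ 0
    signedSum-zero zero    = refl
    signedSum-zero (suc d) rewrite signedSum-zero d = refl
  card-sphere⁺ d (suc n) = begin
    length (map (+ 1 ∷_) zs ++ map incrementHead ps)
      ≡⟨ trans (Listₚ.length-++ (map (+ 1 ∷_) zs))
           (cong₂ ℕ._+_ (Listₚ.length-map (+ 1 ∷_) zs) (Listₚ.length-map incrementHead ps)) ⟩
    length zs ℕ.+ length ps
      ≡⟨ cong₂ ℕ._+_ (card-sphere d n) (card-sphere⁺ d n) ⟩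
    signedSum d (compositions n) ℕ.+ signedSum d (compositions n ∘ suc)
      -- The two cases for the head add up to the defining recurrence of
      -- `compositions (suc n) (suc j)`.
      ≡⟨ signedSum-+ d (compositions n) (compositions n ∘ suc) ⟨
    signedSum d (compositions (suc n) ∘ suc) ∎
    where
    open ≡-Reasoning
    zs = elements (sphere d n)
    ps = elements (sphere⁺ d n)

-- Primitive points of a given norm.

∃-prime-divisor : ∀ n .{{_ : NonZero n}} → n ≢ 1 → ∃ λ k → Prime (suc k) × suc k ∣ n
∃-prime-divisor n n≢1 with factorise n
... | record { factors = [] ; isFactorisation = n≡1 } = contradiction n≡1 n≢1
... | record { factors = zero ∷ _ ; factorsPrime = () ∷ _ }
... | record { factors = suc k ∷ ps ; isFactorisation = n≡ ; factorsPrime = pk ∷ _ } =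
  k , pk , subst (suc k ∣_) (sym n≡) (m∣m*n (product ps))

Free : List ℕ → ∀ {d} → Pred (ℤ^ d) _
Free ks x = All (λ k → ¬ suc k ∣ content x) ks

free? : ∀ ks {d} → Decidable (Free ks {d})
free? ks x = All.all? (λ k → ¬? (suc k ∣? content x)) ks

freeSphere : ∀ ks d n → Enumeration (Sphere d n ∩ Free ks)
freeSphere ks d n = restrict (free? ks) (sphere d n)

card-freeSphere-[] : ∀ d n → card (freeSphere [] d n) ≡ card (sphere d n)
card-freeSphere-[] d n = card-≡ (relabel proj₁ (_, []) (freeSphere [] d n)) (sphere d n)

-- The points lost by adding `suc k` to the list are the images under `scale (suc k)` of the points
-- of norm `m`. Scaling preserves and reflects freeness from `ks`, whose primes differ from `suc k`.
-- The equation is additive to stay within ℕ; the difference that `sieve` needs is formed later in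
-- ℚ.
card-freeSphere-∷ : ∀ k ks d m → Prime (suc k) → All (Prime ∘ suc) ks → All (k ≢_) ks →
  card (freeSphere ks d (suc k *ℕ m)) ≡
  card (freeSphere (k ∷ ks) d (suc k *ℕ m)) ℕ.+ card (freeSphere ks d m)
card-freeSphere-∷ k ks d m pk pks k≢ks = begin
  card (freeSphere ks d n)
    ≡⟨ card-≡ (freeSphere ks d n) partition ⟩
  length (elements (freeSphere (k ∷ ks) d n) ++ map (scale (suc k)) (elements (freeSphere ks d m)))
    ≡⟨ Listₚ.length-++ (elements (freeSphere (k ∷ ks) d n)) ⟩
  card (freeSphere (k ∷ ks) d n) ℕ.+ length (map (scale (suc k)) (elements (freeSphere ks d m)))
    ≡⟨ cong (card (freeSphere (k ∷ ks) d n) ℕ.+_) (Listₚ.length-map (scale (suc k)) (elements (freeSphere ks d m))) ⟩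
  card (freeSphere (k ∷ ks) d n) ℕ.+ card (freeSphere ks d m) ∎
  where
  open ≡-Reasoning
  n = suc k *ℕ m
  Multiple : Pred (ℤ^ d) _
  Multiple = (Sphere d n ∩ Free ks) ∩ (λ x → suc k ∣ content x)
  split : ∀ x → (Sphere d n ∩ Free ks) x → (Sphere d n ∩ Free (k ∷ ks)) x ⊎ Multiple x
  split x (eq , free) with suc k ∣? content x
  ... | yes k∣ = inj₂ ((eq , free) , k∣)
  ... | no  k∤ = inj₁ (eq , k∤ ∷ free)
  multiple : ∀ x → (Sphere d m ∩ Free ks) x → Multiple (scale (suc k) x)
  multiple x (eq , free) =
    ( trans (norm-scale (suc k) x) (cong (suc k *ℕ_) eq)
    , All.zipWith (λ { {r} ((pr , r∤) , k≢r) r∣ → r∤ (prime-∣-cofactor (content x) pk pr (k≢r ∘ ℕₚ.suc-injective)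
                                          (subst (suc r ∣_) (content-scale (suc k) x) r∣)) })
        (All.zip (pks , free) , k≢ks))
    , subst (suc k ∣_) (sym (content-scale (suc k) x)) (m∣m*n (content x))
  cofactor : ∀ y → Multiple y → ∃ λ x → (Sphere d m ∩ Free ks) x × scale (suc k) x ≡ y
  cofactor y ((eq , free) , k∣) with ∣content⇒scale y k∣
  ... | x , refl = x
    , ( ℕₚ.*-cancelˡ-≡ ‖ x ‖₁ m (suc k) (trans (sym (norm-scale (suc k) x)) eq)
      , All.map (λ {r} r∤ r∣ → r∤ (subst (suc r ∣_) (sym (content-scale (suc k) x)) (∣n⇒∣m*n (suc k) r∣))) free)
    , refl
  partition : Enumeration (Sphere d n ∩ Free ks)
  partition = union
    (λ { (eq , _ ∷ free) → eq , free }) proj₁ (λ {x} → split x) (λ { (_ , k∤ ∷ _) (_ , k∣) → k∤ k∣ })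
    (freeSphere (k ∷ ks) d n)
    (image (scale (suc k)) (scale-injective (suc k)) (λ {x} → multiple x) (λ {y} → cofactor y) (freeSphere ks d m))

ℙ⇒Free : ∀ {d ks} (x : ℤ^ d) → All (Prime ∘ suc) ks → ℙ d x → Free ks x
ℙ⇒Free x pks prim = All.map (λ {k} pk k∣ →
  ¬prime[1] (subst Prime (∣1⇒≡1 (subst (suc k ∣_) prim k∣)) pk)) pks

-- A content other than 1 has a prime divisor. It divides the norm `n` too, so it is on the list,
-- against freeness.
Free⇒ℙ : ∀ {d} n .{{_ : NonZero n}} (x : ℤ^ d) → Sphere d n x → Free (predPrimeDivisors n) x → ℙ d x
Free⇒ℙ n x eq free with content x ℕₚ.≟ 1
... | yes prim = prim
... | no  c≢1  =
  let k , pk , k∣c = ∃-prime-divisor (content x) c≢1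
      k∣n = ∣-trans k∣c c∣n
  in contradiction k∣c (All.lookup free
       (∈-filter⁺ (predPrimeDivisor? n) (∈-upTo⁺ (∣⇒≤ k∣n)) (pk , k∣n)))
  where
  c∣n : content x ∣ n
  c∣n = subst (content x ∣_) eq (content-∣-norm x)
  -- A content of 0 would divide `n` and force `n = 0`; being non-zero is what allows the content to
  -- be factorised.
  instance
    c≢0 : NonZero (content x)
    c≢0 = ℕ.≢-nonZero (λ c≡0 → ℕ.≢-nonZero⁻¹ n (0∣⇒≡0 (subst (_∣ n) c≡0 c∣n)))

primitiveSphere : ∀ d n .{{_ : NonZero n}} → Enumeration (Sphere d n ∩ ℙ d)
primitiveSphere d n = relabel
  (λ {x} (eq , free) → eq , Free⇒ℙ n x eq free)
  (λ {x} (eq , prim) → eq , ℙ⇒Free x (predPrimeDivisors-prime n) prim)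
  (freeSphere (predPrimeDivisors n) d n)

card-primitiveSphere : ∀ d n .{{_ : NonZero n}} →
  fromℕ (card (primitiveSphere d n)) ≡ sphereFunctional d (λ q → J q n)
card-primitiveSphere d n = sieve-J (sphereFunctional-linear d) n (λ ks m → fromℕ (card (freeSphere ks d m)))
  (λ m _ → trans (cong fromℕ (trans (card-freeSphere-[] d m) (card-sphere d m))) (sphereFunctional-powers d m))
  step
  where
  step : ∀ k ks m → .{{NonZero m}} → Prime (suc k) → All (Prime ∘ suc) ks → All (k ≢_) ks →
    fromℕ (card (freeSphere (k ∷ ks) d (suc k *ℕ m))) ≡
    fromℕ (card (freeSphere ks d (suc k *ℕ m))) - fromℕ (card (freeSphere ks d m))
  step k ks m pk pks k≢ks = begin
    x                ≡⟨ solve 2 (λ x y → x := (x :+ y) :- y) refl x y ⟩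
    (x + y) - y      ≡⟨ cong (_- y) (trans (cong fromℕ (card-freeSphere-∷ k ks d m pk pks k≢ks))
                          (fromℕ-homo-+ (card (freeSphere (k ∷ ks) d (suc k *ℕ m))) (card (freeSphere ks d m)))) ⟨
    fromℕ (card (freeSphere ks d (suc k *ℕ m))) - y ∎
    where
    open ≡-Reasoning
    open ℚ-Solver
    x y : ℚ
    x = fromℕ (card (freeSphere (k ∷ ks) d (suc k *ℕ m)))
    y = fromℕ (card (freeSphere ks d m))

-- Primitive points of the ball, sphere by sphere.

primitiveBall : ∀ d p → Enumeration (B d p ∩ ℙ d)
-- The origin has content 0 and is not primitive, so the norms start at 1, where the formulas for
-- spheres hold.
primitiveBall d zero    = empty λ {x} (norm≤0 , prim) →
  contradiction (trans (sym (norm≡0⇒content≡0 x (ℕₚ.n≤0⇒n≡0 norm≤0))) prim) λ ()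
primitiveBall d (suc p) = union
  (λ (norm≤p , prim) → ℕₚ.m≤n⇒m≤1+n norm≤p , prim)
  (λ (eq , prim) → ℕₚ.≤-reflexive eq , prim)
  (λ (norm≤1+p , prim) → [ (λ norm<1+p → inj₁ (ℕ.s≤s⁻¹ norm<1+p , prim)) , (λ eq → inj₂ (eq , prim)) ]′
                           (ℕₚ.m≤n⇒m<n∨m≡n norm≤1+p))
  (λ (norm≤p , _) (eq , _) → ℕₚ.<⇒≢ (s≤s norm≤p) eq)
  (primitiveBall d p) (primitiveSphere d (suc p))

-- A weight that depends on the norm alone is constant on each sphere, so every sphere contributes
-- its weight times its number of primitive points.
total-primitiveBall : ∀ d p (w : ℕ → ℕ) →
  fromℕ (total (λ x → w ‖ x ‖₁) (primitiveBall d p)) ≡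
  Σ< p (λ k → fromℕ (w (suc k)) * sphereFunctional d (λ q → J q (suc k)))
total-primitiveBall d zero    w = refl
total-primitiveBall d (suc p) w = begin
  fromℕ (total w′ (primitiveBall d (suc p)))
    ≡⟨ cong fromℕ (sum-map-++ w′ (elements (primitiveBall d p)) (elements S)) ⟩
  fromℕ (total w′ (primitiveBall d p) ℕ.+ total w′ S)
    ≡⟨ cong (λ x → fromℕ (total w′ (primitiveBall d p) ℕ.+ x))
         (sum-map-const w′ (w (suc p)) (elements S) (cong w ∘ proj₁ ∘ ∈⇒ S)) ⟩
  fromℕ (total w′ (primitiveBall d p) ℕ.+ w (suc p) *ℕ card S)
    ≡⟨ trans (fromℕ-homo-+ (total w′ (primitiveBall d p)) (w (suc p) *ℕ card S))
         (cong₂ _+_ (total-primitiveBall d p w) (trans (fromℕ-homo-* (w (suc p)) (card S))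
           (cong (fromℕ (w (suc p)) *_) (card-primitiveSphere d (suc p))))) ⟩
  Σ< p f + f p
    ≡⟨ Σ<-last p f ⟨
  Σ< (suc p) f ∎
  where
  open ≡-Reasoning
  w′ : ℤ^ d → ℕ
  w′ x = w ‖ x ‖₁
  S = primitiveSphere d (suc p)
  f : ℕ → ℚ
  f k = fromℕ (w (suc k)) * sphereFunctional d (λ q → J q (suc k))

-- The sign of the first non-zero coordinate.

FNP-+0 : ∀ {d} {x : ℤ^ d} → FirstNonzeroPositive x → FirstNonzeroPositive (0ℤ ∷ x)
FNP-+0 (i , zeros , pos) = suc i , (λ { zero _ → refl ; (suc j) (s≤s j<i) → zeros j j<i }) , pos

-- The case of content 0 is that of the zero vector; primitive points, having content 1, avoid it.
FNP-trichotomy : ∀ {d} (x : ℤ^ d) → content x ≡ 0 ⊎ FirstNonzeroPositive x ⊎ FirstNonzeroPositive (negate x)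
FNP-trichotomy []             = inj₁ refl
FNP-trichotomy (+[1+ n ] ∷ x) = inj₂ (inj₁ (zero , (λ _ ()) , +<+ (s≤s z≤n)))
FNP-trichotomy (-[1+ n ] ∷ x) = inj₂ (inj₂ (zero , (λ _ ()) , +<+ (s≤s z≤n)))
FNP-trichotomy (+0 ∷ x) with FNP-trichotomy x
... | inj₁ c≡0        = inj₁ (trans (gcd-identityˡ (content x)) c≡0)
... | inj₂ (inj₁ fnp) = inj₂ (inj₁ (FNP-+0 fnp))
... | inj₂ (inj₂ fnp) = inj₂ (inj₂ (FNP-+0 fnp))

-- If the two witnesses are at different positions, the earlier one would be both zero and non-zero;
-- at the same position the signs clash.
FNP-asym : ∀ {d} {x : ℤ^ d} → FirstNonzeroPositive x → FirstNonzeroPositive (negate x) → ⊥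
FNP-asym {x = z ∷ x} (zero , _ , pos) (zero , _ , neg-pos) = ℤₚ.<-asym pos (ℤₚ.neg-cancel-< neg-pos)
FNP-asym {x = z ∷ x} (zero , _ , pos) (suc j , zeros , _) =
  ℤₚ.<⇒≢ pos (sym (ℤₚ.neg-injective {j = 0ℤ} (zeros zero (s≤s z≤n))))
FNP-asym {x = z ∷ x} (suc i , zeros , _) (zero , _ , neg-pos) =
  ℤₚ.<⇒≢ neg-pos (cong neg (sym (zeros zero (s≤s z≤n))))
FNP-asym {x = z ∷ x} (suc i , zeros , pos) (suc j , zeros′ , neg-pos) =
  FNP-asym {x = x} (i , (λ k k<i → zeros (suc k) (s≤s k<i)) , pos)
                   (j , (λ k k<j → zeros′ (suc k) (s≤s k<j)) , neg-pos)

symmetrize : ∀ {d p} → Enumeration (B d p ∩ ℙ∘ d) → Enumeration (B d p ∩ ℙ d)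
symmetrize {d} {p} X = union {Q = B d p ∩ ℙ d ∩ (FirstNonzeroPositive ∘ negate)}
  (λ (norm≤p , prim , _) → norm≤p , prim)
  (λ (norm≤p , prim , _) → norm≤p , prim)
  (λ {x} → split x)
  (λ {x} (_ , _ , fnp) (_ , _ , fnp′) → FNP-asym {x = x} fnp fnp′)
  X
  (image negate negate-injective
    (λ {x} (norm≤p , prim , fnp) → ℕₚ.≤-trans (ℕₚ.≤-reflexive (norm-negate x)) norm≤p
      , trans (content-negate x) prim , subst FirstNonzeroPositive (sym (negate-involutive x)) fnp)
    (λ {y} (norm≤p , prim , fnp) → negate y
      , (ℕₚ.≤-trans (ℕₚ.≤-reflexive (norm-negate y)) norm≤p , trans (content-negate y) prim , fnp)
      , negate-involutive y)
    X)
  where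
  split : ∀ x → (B d p ∩ ℙ d) x → (B d p ∩ ℙ∘ d) x ⊎ (B d p ∩ ℙ d ∩ (FirstNonzeroPositive ∘ negate)) x
  split x (norm≤p , prim) with FNP-trichotomy x
  ... | inj₁ c≡0         = contradiction (trans (sym c≡0) prim) λ ()
  ... | inj₂ (inj₁ fnp)  = inj₁ (norm≤p , prim , fnp)
  ... | inj₂ (inj₂ fnp)  = inj₂ (norm≤p , prim , fnp)

total-symmetrize : ∀ {d p} (X : Enumeration (B d p ∩ ℙ∘ d)) (w : ℤ^ d → ℕ) → (∀ x → w (negate x) ≡ w x) →
  (Y : Enumeration (B d p ∩ ℙ d)) → total w Y ≡ 2 *ℕ total w X
total-symmetrize X w w-even Y = begin
  total w Y                                          ≡⟨ total-≡ w Y (symmetrize X) ⟩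
  total w (symmetrize X)                             ≡⟨ sum-map-++ w (elements X) (map negate (elements X)) ⟩
  total w X ℕ.+ sum (map w (map negate (elements X))) ≡⟨ cong (total w X ℕ.+_) (sum-map-map w negate w-even (elements X)) ⟩
  total w X ℕ.+ total w X                            ≡⟨ cong (total w X ℕ.+_) (ℕₚ.+-identityʳ (total w X)) ⟨
  2 *ℕ total w X                                    ∎
  where open ≡-Reasoning

-- Permutation of coordinates and the value of κ.

sum-map-+ : (f g : A → ℕ) (xs : List A) →
  sum (map (λ x → f x ℕ.+ g x) xs) ≡ sum (map f xs) ℕ.+ sum (map g xs)
sum-map-+ f g []       = refl
sum-map-+ f g (x ∷ xs) rewrite sum-map-+ f g xs =
  solve 4 (λ a b c d → (a :+ b) :+ (c :+ d) := (a :+ c) :+ (b :+ d)) refl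
    (f x) (g x) (sum (map f xs)) (sum (map g xs))
  where open ℕ-Solver

sum-swap : (f : A → A′ → ℕ) (xs : List A) (ys : List A′) →
  sum (map (λ x → sum (map (f x) ys)) xs) ≡ sum (map (λ y → sum (map (λ x → f x y) xs)) ys)
sum-swap f []       ys = sym (sum-map-const (λ _ → 0) 0 ys (λ _ → refl))
sum-swap f (x ∷ xs) ys = trans (cong (sum (map (f x) ys) ℕ.+_) (sum-swap f xs ys))
                               (sym (sum-map-+ (f x) (λ y → sum (map (λ x → f x y) xs)) ys))

norm≡sum-lookup : ∀ {d} (x : ℤ^ d) → ‖ x ‖₁ ≡ sum (map (λ i → ∣ lookup x i ∣) (allFin d))
norm≡sum-lookup []      = refl
norm≡sum-lookup {suc d} (z ∷ x) = cong (∣ z ∣ ℕ.+_) (trans (norm≡sum-lookup x) (cong sum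
  (trans (Listₚ.map-tabulate id (λ i → ∣ lookup x i ∣))
         (sym (Listₚ.map-tabulate suc (λ i → ∣ lookup (z ∷ x) i ∣))))))

lookup-negate : ∀ {d} (x : ℤ^ d) i → ∣ lookup (negate x) i ∣ ≡ ∣ lookup x i ∣
lookup-negate x i = trans (cong ∣_∣ (Vecₚ.lookup-map i neg x)) (ℤₚ.∣-i∣≡∣i∣ (lookup x i))

swapHead : ∀ {d} → Fin d → Vec A (suc d) → Vec A (suc d)
swapHead i (z ∷ x) = lookup x i ∷ x [ i ]≔ z

swapHead-involutive : ∀ {d} (i : Fin d) (x : Vec A (suc d)) → swapHead i (swapHead i x) ≡ x
swapHead-involutive i (z ∷ x) = cong₂ _∷_ (Vecₚ.lookup∘update i x z)
  (trans (Vecₚ.[]≔-idempotent x i) (Vecₚ.[]≔-lookup x i))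

swapHead-injective : ∀ {d} (i : Fin d) {x y : Vec A (suc d)} → swapHead i x ≡ swapHead i y → x ≡ y
swapHead-injective i {x} {y} eq =
  trans (sym (swapHead-involutive i x)) (trans (cong (swapHead i) eq) (swapHead-involutive i y))

-- General in `f` so as to serve both the sum in the norm and the gcd in the content. For `suc i`,
-- the second entry is moved to the front, the induction hypothesis swaps behind it, and it is moved
-- back.
foldr-swapHead : (f : A′ → A′ → A′) (e : A′) (h : A → A′) →
  (∀ a b c → f a (f b c) ≡ f b (f a c)) → ∀ {d} (i : Fin d) (x : Vec A (suc d)) →
  Vec.foldr′ f e (Vec.map h (swapHead i x)) ≡ Vec.foldr′ f e (Vec.map h x)
foldr-swapHead f e h comm zero    (z ∷ a ∷ x) = comm (h a) (h z) _
foldr-swapHead f e h comm (suc i) (z ∷ a ∷ x) = begin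
  f b (f (h a) r′)  ≡⟨ comm b (h a) r′ ⟩
  f (h a) (f b r′)  ≡⟨ cong (f (h a)) (foldr-swapHead f e h comm i (z ∷ x)) ⟩
  f (h a) (f (h z) r) ≡⟨ comm (h a) (h z) r ⟩
  f (h z) (f (h a) r) ∎
  where
  open ≡-Reasoning
  b  = h (lookup x i)
  r′ = Vec.foldr′ f e (Vec.map h (x [ i ]≔ z))
  r  = Vec.foldr′ f e (Vec.map h x)

norm-swapHead : ∀ {d} (i : Fin d) (x : ℤ^ (suc d)) → ‖ swapHead i x ‖₁ ≡ ‖ x ‖₁
norm-swapHead = foldr-swapHead ℕ._+_ 0 ∣_∣ λ a b c →
  trans (sym (ℕₚ.+-assoc a b c)) (trans (cong (ℕ._+ c) (ℕₚ.+-comm a b)) (ℕₚ.+-assoc b a c))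

content-swapHead : ∀ {d} (i : Fin d) (x : ℤ^ (suc d)) → content (swapHead i x) ≡ content x
content-swapHead = foldr-swapHead gcd 0 ∣_∣ λ a b c →
  trans (sym (gcd-assoc a b c)) (trans (cong (λ g → gcd g c) (gcd-comm a b)) (gcd-assoc b a c))

total-lookup : ∀ {d p} (Y : Enumeration (B (suc d) p ∩ ℙ (suc d))) i →
  total (λ x → ∣ lookup x i ∣) Y ≡ total (λ x → ∣ lookup x zero ∣) Y
total-lookup         Y zero    = refl
total-lookup {d} {p} Y (suc i) = trans
  (total-≡ (λ x → ∣ lookup x (suc i) ∣) Y (image (swapHead i) (swapHead-injective i)
    (λ {x} → symmetric x) (λ {y} prim → swapHead i y , symmetric y prim , swapHead-involutive i y) Y))
  (sum-map-map (λ x → ∣ lookup x (suc i) ∣) (swapHead i)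
    (λ { (z ∷ x) → cong ∣_∣ (Vecₚ.lookup∘update i x z) }) (elements Y))
  where
  symmetric : ∀ x → (B (suc d) p ∩ ℙ (suc d)) x → (B (suc d) p ∩ ℙ (suc d)) (swapHead i x)
  symmetric x (norm≤p , prim) =
    ℕₚ.≤-trans (ℕₚ.≤-reflexive (norm-swapHead i x)) norm≤p , trans (content-swapHead i x) prim

module _ {d p : ℕ} (X : Enumeration (B (suc d) p ∩ ℙ∘ (suc d))) where

  coordinateSum : Fin (suc d) → ℕ
  coordinateSum i = total (λ x → ∣ lookup x i ∣) X

  -- `ℙ∘` is not invariant under transpositions, since its sign condition depends on the order of
  -- the coordinates. The symmetrized set is invariant, and it doubles every coordinate sum because
  -- absolute values are even; the factor 2 is then cancelled.
  coordinateSum-constant : ∀ i → coordinateSum i ≡ coordinateSum zero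
  coordinateSum-constant i = ℕₚ.*-cancelˡ-≡ (coordinateSum i) (coordinateSum zero) 2
    (trans (sym (double i)) (trans (total-lookup (symmetrize X) i) (double zero)))
    where
    double : ∀ i → total (λ x → ∣ lookup x i ∣) (symmetrize X) ≡ 2 *ℕ coordinateSum i
    double i = total-symmetrize X (λ x → ∣ lookup x i ∣) (λ x → lookup-negate x i) (symmetrize X)

  κ≡coordinateSum : κ X ≡ coordinateSum zero
  κ≡coordinateSum = ℕₚ.≤-antisym
    (max≤v⁺ {xs = map coordinateSum (allFin (suc d))} z≤n
      (Allₚ.map⁺ (All.tabulate (λ {i} _ → ℕₚ.≤-reflexive (coordinateSum-constant i)))))
    (v≤max⁺ 0 (map coordinateSum (allFin (suc d))) (inj₂ (here ℕₚ.≤-refl)))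

  -- Double counting: summed by coordinates, the norms give `suc d` coordinate sums, each equal to
  -- κ.
  total-norm : total ‖_‖₁ X ≡ κ X *ℕ suc d
  total-norm = begin
    total ‖_‖₁ X
      ≡⟨ cong sum (Listₚ.map-cong norm≡sum-lookup (elements X)) ⟩
    sum (map (λ x → sum (map (λ i → ∣ lookup x i ∣) (allFin (suc d)))) (elements X))
      ≡⟨ sum-swap (λ x i → ∣ lookup x i ∣) (elements X) (allFin (suc d)) ⟩
    sum (map coordinateSum (allFin (suc d)))
      ≡⟨ sum-map-const coordinateSum (coordinateSum zero) (allFin (suc d)) (λ {i} _ → coordinateSum-constant i) ⟩
    coordinateSum zero *ℕ length (allFin (suc d))
      ≡⟨ cong₂ ℕ._*_ (sym κ≡coordinateSum) (Listₚ.length-tabulate {n = suc d} id) ⟩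
    κ X *ℕ suc d ∎
    where open ≡-Reasoning

-- The two formulas.

-- Both formulas come from here: the weight constantly 1 counts the points, and the identity sums
-- the norms. The factor 2 is the passage from `ℙ∘` to all primitive points.
total-norm-weights : ∀ {d p} (X : Enumeration (B d p ∩ ℙ∘ d)) (w : ℕ → ℕ) →
  fromℕ 2 * fromℕ (total (λ x → w ‖ x ‖₁) X) ≡
  ∑[ j from 1 to d ] (fromℕ ((2 ^ j) *ℕ (d C j)) * ∑[ i from j to p ] (fromℕ (w i) * cψ i j))
total-norm-weights {d} {p} X w = begin
  fromℕ 2 * fromℕ (total w′ X)
    ≡⟨ fromℕ-homo-* 2 (total w′ X) ⟨
  fromℕ (2 *ℕ total w′ X)
    ≡⟨ cong fromℕ (total-symmetrize X w′ (λ x → cong w (norm-negate x)) (primitiveBall d p)) ⟨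
  fromℕ (total w′ (primitiveBall d p))
    ≡⟨ total-primitiveBall d p w ⟩
  Σ< p (λ k → fromℕ (w (suc k)) * sphereFunctional d (λ q → J q (suc k)))
    ≡⟨ Σ<-sphereFunctional d p (fromℕ ∘ w) ⟩
  ∑[ j from 1 to d ] (fromℕ ((2 ^ j) *ℕ (d C j)) * ∑[ i from j to p ] (fromℕ (w i) * cψ i j)) ∎
  where
  open ≡-Reasoning
  w′ : ℤ^ d → ℕ
  w′ x = w ‖ x ‖₁

∑-cong : ∀ a b {f g} → f ≗ g → ∑ a b f ≡ ∑ a b g
∑-cong a b f≗g = cong (foldr _+_ 0ℚ) (Listₚ.map-cong (f≗g ∘ (a ℕ.+_)) (upTo (suc b ℕ.∸ a)))

theorem1p1 : (d p : ℕ) .{{_ : NonZero d}} .{{_ : NonZero p}}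
    (X : Enumeration (B d p ∩ ℙ∘ d)) →
    (fromℕ (card X) ≡
    ½ * ∑[ j from 1 to d ] (fromℕ ((2 ^ j) *ℕ (d C j)) * ∑[ i from j to p ] cψ i j))
    × (fromℕ (κ X) ≡
    (+ 1 / (2 *ℕ d)) {{m*n≢0 2 d}}
    * ∑[ j from 1 to d ] (fromℕ ((2 ^ j) *ℕ (d C j)) * ∑[ i from j to p ] (fromℕ i * cψ i j)))
theorem1p1 d@(suc _) p X = cardinality , coordinates
  where
  open ≡-Reasoning
  c : ℕ → ℚ
  c j = fromℕ ((2 ^ j) *ℕ (d C j))
  cancel : ∀ r x y → r * x ≡ 1ℚ → r * (x * y) ≡ y
  cancel r x y rx≡1 = trans (sym (ℚₚ.*-assoc r x y)) (trans (cong (_* y) rx≡1) (ℚₚ.*-identityˡ y))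
  cardinality : fromℕ (card X) ≡ ½ * ∑[ j from 1 to d ] (c j * ∑[ i from j to p ] cψ i j)
  cardinality = begin
    fromℕ (card X)
      ≡⟨ cong fromℕ (trans (sum-map-const (λ _ → 1) 1 (elements X) (λ _ → refl)) (ℕₚ.*-identityˡ (card X))) ⟨
    fromℕ (total (λ _ → 1) X)
      ≡⟨ cancel ½ (fromℕ 2) (fromℕ (total (λ _ → 1) X)) refl ⟨
    ½ * (fromℕ 2 * fromℕ (total (λ _ → 1) X))
      ≡⟨ cong (½ *_) (total-norm-weights X (λ _ → 1)) ⟩
    ½ * ∑[ j from 1 to d ] (c j * ∑[ i from j to p ] (1ℚ * cψ i j))
      ≡⟨ cong (½ *_) (∑-cong 1 d (λ j → cong (c j *_) (∑-cong j p (λ i → ℚₚ.*-identityˡ (cψ i j))))) ⟩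
    ½ * ∑[ j from 1 to d ] (c j * ∑[ i from j to p ] cψ i j) ∎
  r = (+ 1 / (2 *ℕ d)) {{m*n≢0 2 d}}
  coordinates : fromℕ (κ X) ≡ r * ∑[ j from 1 to d ] (c j * ∑[ i from j to p ] (fromℕ i * cψ i j))
  coordinates = begin
    fromℕ (κ X)
      ≡⟨ cancel r (fromℕ (2 *ℕ d)) (fromℕ (κ X)) (1/n*n≡1 (2 *ℕ d)) ⟨
    r * (fromℕ (2 *ℕ d) * fromℕ (κ X))
      ≡⟨ cong (r *_) (fromℕ-homo-* (2 *ℕ d) (κ X)) ⟨
    -- `d` times κ is the sum of the norms, which brings in the weight `id`.
    r * fromℕ (2 *ℕ d *ℕ κ X)
      ≡⟨ cong (λ x → r * fromℕ x) (trans (ℕₚ.*-assoc 2 d (κ X))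
           (cong (2 *ℕ_) (trans (ℕₚ.*-comm d (κ X)) (sym (total-norm X))))) ⟩
    r * fromℕ (2 *ℕ total ‖_‖₁ X)
      ≡⟨ cong (r *_) (trans (fromℕ-homo-* 2 (total ‖_‖₁ X)) (total-norm-weights X id)) ⟩
    r * ∑[ j from 1 to d ] (c j * ∑[ i from j to p ] (fromℕ i * cψ i j)) ∎
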